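{- Let $r\ge 3$ be an integer. (i) If $r\equiv 0$ or $2\pmod 3$, then there is a bijection $\tau:F^r\to F^r$ such that $S_{\mathcal H,\tau}$ is a propelinear extended perfect code of length $2^{r+1}$ with $\mathrm{rank}(S_{\mathcal H,\tau})=2^{r+1}-2$ and $\dim(\mathrm{Ker}(S_{\mathcal H,\tau}))=2^{r+1}-2r-2$. (ii) If $r\equiv 1\pmod 3$, then there is a bijection $\tau:F^r\to F^r$ such that $S_{\mathcal H,\tau}$ is a propelinear extended perfect code of length $2^{r+1}$ with $\mathrm{rank}(S_{\mathcal H,\tau})=2^{r+1}-2$ and $\dim(\mathrm{Ker}(S_{\mathcal H,\tau}))=2^{r+1}-2r-1$, and there is a bijection $\tau:F^r\to F^r$ such that $S_{\mathcal H,\tau}$ is a propelinear extended perfect code (of length $2^{r+1}$) with $\mathrm{rank}(S_{\mathcal H,\tau})=2^{r+1}-3$ and $\dim(\mathrm{Ker}(S_{\mathcal H,\tau}))=2^{r+1}-2r-2$.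
   Context: $F=\mathrm{GF}(2)$; $F^n$ carries the Hamming metric; a code of length $n$ is a set of vectors of $F^n$, whose elements are called codewords. $\mathrm{wt}$ is Hamming weight. ${\bf 0}$ denotes the all-zero vector. A code $C\subseteq F^n$ is perfect if for every $x\in F^n$ there is exactly one $y\in C$ at Hamming distance at most $1$ from $x$. An extended perfect code is obtained from a perfect code by adding an overall parity check coordinate to all codewords (its position is immaterial). The rank of a code is the dimension of its linear span over $F$. The kernel $\mathrm{Ker}(C)$ of a code $C$ of length $n$ is the set of all $x\in F^n$ with $x+C=C$ (a linear subspace). $\mathrm{Aut}(F^n)$ is the group of all transformations $(x,\pi)$, $x\in F^n$, $\pi$ a permutation of the coordinate positions, acting by $(x,\pi)(y)=x+\pi(y)$ where $\pi(y)=(y_{\pi^{ -1}(1)},\ldots,y_{\pi^{ -1}(n)})$. $\mathrm{Aut}(C)$ is the setwise stabilizer of $C$ in $\mathrm{Aut}(F^n)$. A code $C$ is propelinear if $\mathrm{Aut}(C)$ has a subgroup of order $|C|$ acting transitively on the codewords of $C$. The coordinates of $F^{2^r}$ are indexed by the vectors of $F^r$; $e_a$ is the vector whose only nonzero coordinate is the one indexed by $a$; $\mathcal H=\{c\in F^{2^r}:\sum_{a:c_a=1}a={\bf 0},\ \mathrm{wt}(c)\equiv 0 \pmod 2\}$ and $\mathcal H_a=\mathcal H+e_a+e_{\bf 0}$ for $a\in F^r$. For a bijection $\tau:F^r\to F^r$, $S_{\mathcal H,\tau}=\bigcup_{a\in F^r}\mathcal H_a\times\mathcal H_{\tau(a)}$,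 where $C\times D=\{x|y:x\in C,y\in D\}$ and $x|y$ is concatenation. -}

module Defs where

open import Algebra.Bundles using (Group)
open import Data.Bool using (Bool; true; false; _∧_; _xor_)
import Data.Bool.Properties as Bool
open import Data.Fin using (Fin; zero; suc)
open import Data.Fin.Permutation as Perm using (Permutation′; _⟨$⟩ˡ_; _∘ₚ_)
open import Data.Fin.Properties using (2↔Bool; *↔×)
open import Data.Nat using (ℕ; suc; _+_; _≤_; _^_)
open import Data.Nat.Divisibility using (_∣_)
open import Data.Product using (Σ-syntax; ∃; ∃-syntax; ∃!; _×_; _,_; proj₁; uncurry)
open import Data.Product.Function.NonDependent.Propositional using (_×-↔_)
open import Data.Vec using (Vec; []; _∷_; _++_; count; foldr′; insertAt; lookup; map; replicate; tabulate; uncons; zip; zipWith; _[_]≔_)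
open import Data.Vec.Properties using (lookup-zipWith; lookup∘tabulate; tabulate∘lookup; tabulate-cong; lookup-replicate; zipWith-assoc; zipWith-identityˡ; zipWith-identityʳ)
open import Data.Vec.Relation.Unary.All using (All)
open import Function.Bundles using (_↔_; _⤖_; Inverse; Bijection; mk↔ₛ′)
open import Function.Construct.Composition using (_↔-∘_)
open import Function.Construct.Identity using (↔-id)
open import Level using (0ℓ)
open import Relation.Binary.Bundles using (Setoid)
import Relation.Binary.Construct.On as On
open import Relation.Binary.PropositionalEquality using (_≡_; refl; sym; trans; cong; cong₂; setoid; module ≡-Reasoning)
open import Relation.Nullary using (¬?)
open import Relation.Unary using (Pred; _⊆_; _≐_)

private
  variable
    m n d : ℕ

-- F n is GF(2)ⁿ, with Bool as GF(2): _xor_ is addition and _∧_ is multiplication.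
F : ℕ → Set
F n = Vec Bool n

𝟎 : F n
𝟎 = replicate _ false

infixl 6 _⊕_
_⊕_ : F n → F n → F n
_⊕_ = zipWith _xor_

infixl 7 _•_
_•_ : Bool → F n → F n
b • x = map (b ∧_) x

wt : F n → ℕ
wt = count (Bool._≟ true)

hamming : F n → F n → ℕ
hamming x y = count (λ p → ¬? (uncurry Bool._≟_ p)) (zip x y)

Code : ℕ → Set₁
Code n = Pred (F n) 0ℓ

codeLength : Code n → ℕ
codeLength {n} _ = n

image : (F m → F n) → Code m → Code n
image f C y = ∃[ x ] (C x × f x ≡ y)

translate : F n → Code n → Code n
translate x = image (x ⊕_)

-- ∑ᵢ cᵢ vᵢ
lincomb : F d → Vec (F n) d → F n
lincomb c vs = foldr′ _⊕_ 𝟎 (zipWith _•_ c vs)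

spannedBy : Vec (F n) d → Code n
spannedBy vs x = ∃[ c ] lincomb c vs ≡ x

span : Code n → Code n
span C x = ∃[ k ] Σ[ vs ∈ Vec _ k ] (All C vs × spannedBy vs x)

LinearlyIndependent : Vec (F n) d → Set
LinearlyIndependent vs = ∀ c → lincomb c vs ≡ 𝟎 → c ≡ 𝟎

-- In particular, this forces V to be a linear subspace.
HasDimension : Code n → ℕ → Set
HasDimension {n} V d =
  Σ[ vs ∈ Vec (F n) d ] (LinearlyIndependent vs × V ≐ spannedBy vs)

HasRank : Code n → ℕ → Set
HasRank C = HasDimension (span C)

Ker : Code n → Code n
Ker C x = translate x C ≐ C

IsPerfect : Code n → Set
IsPerfect C = ∀ x → ∃! _≡_ λ y → C y × hamming x y ≤ 1

parity : F n → Bool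
parity = foldr′ _xor_ false

extendAt : Fin (suc m) → F m → F (suc m)
extendAt p x = insertAt x p (parity x)

data IsExtendedPerfect : Code n → Set₁ where
  extended : (C : Code m) → IsPerfect C →
             (p : Fin (suc m)) →
             (D : Code (suc m)) → D ≐ image (extendAt p) C →
             IsExtendedPerfect D

permute : Permutation′ n → F n → F n
permute π y = tabulate λ i → lookup y (π ⟨$⟩ˡ i)

private
  permute-∘ : (π σ : Permutation′ n) (y : F n) →
              permute (σ ∘ₚ π) y ≡ permute π (permute σ y)
  permute-∘ π σ y = tabulate-cong λ i → sym (lookup∘tabulate _ (π ⟨$⟩ˡ i))

  permute-⊕ : (π : Permutation′ n) (x y : F n) →
              permute π (x ⊕ y) ≡ permute π x ⊕ permute π y
  permute-⊕ π x y = begin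
    permute π (x ⊕ y)
      ≡⟨ tabulate-cong (λ i → begin
           lookup (x ⊕ y) (π ⟨$⟩ˡ i)
             ≡⟨ lookup-zipWith _xor_ (π ⟨$⟩ˡ i) x y ⟩
           lookup x (π ⟨$⟩ˡ i) xor lookup y (π ⟨$⟩ˡ i)
             ≡⟨ cong₂ _xor_ (lookup∘tabulate _ i) (lookup∘tabulate _ i) ⟨
           lookup (permute π x) i xor lookup (permute π y) i
             ≡⟨ lookup-zipWith _xor_ i (permute π x) (permute π y) ⟨
           lookup (permute π x ⊕ permute π y) i ∎) ⟩
    tabulate (lookup (permute π x ⊕ permute π y))
      ≡⟨ tabulate∘lookup _ ⟩
    permute π x ⊕ permute π y ∎
    where open ≡-Reasoning

  permute-𝟎 : (π : Permutation′ n) → permute π 𝟎 ≡ 𝟎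
  permute-𝟎 π = trans
    (tabulate-cong λ i → trans (lookup-replicate (π ⟨$⟩ˡ i) false) (sym (lookup-replicate i false)))
    (tabulate∘lookup 𝟎)

  from-cong : {π σ : Permutation′ n} → π Perm.≈ σ → ∀ i → π ⟨$⟩ˡ i ≡ σ ⟨$⟩ˡ i
  from-cong {π = π} {σ} π≈σ i = trans
    (cong (π ⟨$⟩ˡ_) (sym (trans (π≈σ (σ ⟨$⟩ˡ i)) (Perm.inverseʳ σ))))
    (Perm.inverseˡ π)

  permute-cong : {π σ : Permutation′ n} → π Perm.≈ σ → ∀ {x y} → x ≡ y → permute π x ≡ permute σ y
  permute-cong {π = π} {σ} π≈σ {x} refl = tabulate-cong λ i → cong (lookup x) (from-cong {π = π} {σ} π≈σ i)

  ⊕-assoc : (x y z : F n) → (x ⊕ y) ⊕ z ≡ x ⊕ (y ⊕ z)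
  ⊕-assoc = zipWith-assoc Bool.xor-assoc

  ⊕-self : (x : F n) → x ⊕ x ≡ 𝟎
  ⊕-self []      = refl
  ⊕-self (b ∷ x) = cong₂ _∷_ (Bool.xor-same b) (⊕-self x)

-- (x , π) stands for the transformation y ↦ x ⊕ permute π y.
Transformation : ℕ → Set
Transformation n = F n × Permutation′ n

act : Transformation n → F n → F n
act (x , π) y = x ⊕ permute π y

-- Note that _∘ₚ_ composes from left to right.
_∙_ : Transformation n → Transformation n → Transformation n
(x , π) ∙ (y , σ) = x ⊕ permute π y , σ ∘ₚ π

act-∙ : (g h : Transformation n) (y : F n) → act (g ∙ h) y ≡ act g (act h y)
act-∙ (x , π) (z , σ) y = begin
  (x ⊕ permute π z) ⊕ permute (σ ∘ₚ π) y        ≡⟨ cong (_ ⊕_) (permute-∘ π σ y) ⟩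
  (x ⊕ permute π z) ⊕ permute π (permute σ y)   ≡⟨ ⊕-assoc x _ _ ⟩
  x ⊕ (permute π z ⊕ permute π (permute σ y))   ≡⟨ cong (x ⊕_) (permute-⊕ π z _) ⟨
  x ⊕ permute π (z ⊕ permute σ y)               ∎
  where open ≡-Reasoning

AutF : ℕ → Group 0ℓ 0ℓ
AutF n = record
  { Carrier = Transformation n
  ; _≈_     = λ (x , π) (y , σ) → x ≡ y × π Perm.≈ σ
  ; _∙_     = _∙_
  ; ε       = 𝟎 , Perm.id
  ; _⁻¹     = λ (x , π) → permute (Perm.flip π) x , Perm.flip π
  ; isGroup = record
    { isMonoid = record
      { isSemigroup = record
        { isMagma = record
          { isEquivalence = record
            { refl  = refl , λ i → refl
            ; sym   = λ (p , q) → sym p , λ i → sym (q i)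
            ; trans = λ (p , q) (p′ , q′) → trans p p′ , λ i → trans (q i) (q′ i)
            }
          ; ∙-cong = λ { {_ , π} {_ , π′} {_ , σ} {_ , σ′} (p , q) (p′ , q′) →
              cong₂ _⊕_ p (permute-cong {π = π} {π′} q p′)
              , λ i → trans (cong (π Perm.⟨$⟩ʳ_) (q′ i)) (q (σ′ Perm.⟨$⟩ʳ i)) }
          }
        ; assoc = λ g h (z , ρ) → act-∙ g h z , λ i → refl
        }
      ; identity =
          (λ (x , π) → trans (zipWith-identityˡ Bool.xor-identityˡ _) (tabulate∘lookup x) , λ i → refl)
        , (λ (x , π) → trans (cong (x ⊕_) (permute-𝟎 π)) (zipWith-identityʳ Bool.xor-identityʳ x) , λ i → refl)
      }
    ; inverse =
        (λ (x , π) → ⊕-self _ , λ i → Perm.inverseˡ π)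
      , (λ (x , π) → trans
            (cong (x ⊕_) (trans (sym (permute-∘ π (Perm.flip π) x))
              (trans (tabulate-cong λ i → cong (lookup x) (Perm.inverseʳ π)) (tabulate∘lookup x))))
            (⊕-self x)
          , λ i → Perm.inverseʳ π)
    ; ⁻¹-cong = λ { {_ , π} {_ , σ} (p , q) →
        let q⁻¹ = from-cong {π = π} {σ} q in
        permute-cong {π = Perm.flip π} {Perm.flip σ} q⁻¹ p , q⁻¹ }
    }
  }

Aut : Code n → Pred (Transformation n) 0ℓ
Aut C g = image (act g) C ≐ C

record IsSubgroup (G : Group 0ℓ 0ℓ) (H : Pred (Group.Carrier G) 0ℓ) : Set where
  open Group G using (_≈_; ε; _⁻¹) renaming (_∙_ to _·_)
  field
    respects   : ∀ {g h} → g ≈ h → H g → H h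
    ε-closed   : H ε
    ∙-closed   : ∀ {g h} → H g → H h → H (g · h)
    ⁻¹-closed  : ∀ {g} → H g → H (g ⁻¹)

subset : (S : Setoid 0ℓ 0ℓ) → Pred (Setoid.Carrier S) 0ℓ → Setoid 0ℓ 0ℓ
subset S P = On.setoid {B = ∃ P} S proj₁

HasCardinality : Setoid 0ℓ 0ℓ → ℕ → Set
HasCardinality S N = Inverse S (setoid (Fin N))

IsTransitiveOn : Pred (Transformation n) 0ℓ → Code n → Set
IsTransitiveOn G C = ∀ {x y} → C x → C y → ∃[ g ] (G g × act g x ≡ y)

IsPropelinear : Code n → Set₁
IsPropelinear {n} C = Σ[ G ∈ Pred (Transformation n) 0ℓ ]
  ( IsSubgroup (AutF n) G
  × G ⊆ Aut C
  × (∃[ N ] (HasCardinality (subset (Group.setoid (AutF n)) G) N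
           × HasCardinality (subset (setoid (F n)) C) N))
  × IsTransitiveOn G C)

∷-↔ : (Bool × F n) ↔ F (suc n)
∷-↔ = mk↔ₛ′ (uncurry _∷_) uncons (λ { (b ∷ x) → refl }) (λ { (b , x) → refl })

-- The indexing of the 2 ^ r coordinate positions by the vectors of F r.
coordinates : ∀ r → Fin (2 ^ r) ↔ F r
coordinates 0       = mk↔ₛ′ (λ _ → []) (λ _ → zero) (λ { [] → refl }) (λ { zero → refl ; (suc ()) })
coordinates (suc r) = ∷-↔ ↔-∘ ((2↔Bool ×-↔ coordinates r) ↔-∘ *↔×)

module _ {r : ℕ} where
  open Inverse (coordinates r) renaming (to to vectorAt; from to positionOf)

  e : F r → F (2 ^ r)
  e a = 𝟎 [ positionOf a ]≔ true

  -- lincomb c (tabulate vectorAt) is the sum of all a with c_a = 1.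
  ℋ : Code (2 ^ r)
  ℋ c = lincomb c (tabulate vectorAt) ≡ 𝟎 × 2 ∣ wt c

  ℋ[_] : F r → Code (2 ^ r)
  ℋ[ a ] = translate (e a ⊕ e 𝟎) ℋ

  S : F r ⤖ F r → Code (2 ^ r + 2 ^ r)
  S τ w = ∃[ a ] ∃[ x ] ∃[ y ] (ℋ[ a ] x × ℋ[ Bijection.to τ a ] y × x ++ y ≡ w)

{-# OPTIONS --safe #-}

-- A word of length 2 ^ r + 2 ^ r lies in S τ iff both halves are even and their syndromes form a
-- pair (a , τ a).  Hence the rank of S τ is governed by the span in F (r + r) of the graph of τ, and
-- its kernel by the periods of that graph, the pairs (x , y) with τ (x ⊕ z) = y ⊕ τ z for all z.
--
-- Suppose that the maps x ↦ a ⋆ x = a ⊕ L a x form a regular group of affine maps and that τ is an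
-- automorphism of (F r , ⋆).  Sending a codeword w with syndromes (a , τ a) to the transformation
-- that permutes the coordinates of the two halves by a ⋆_ and τ a ⋆_ and then adds w gives a group
-- acting regularly on S τ, because syndromes of even words turn these products into ⋆.
--
-- Groups, automorphisms, spans and periods are all compatible with direct products, so the
-- theorem follows from single examples with r = 3, 4, 4, 5 by adding copies of the one with r = 3.

module Submission where

open import Defs
open import Algebra.Bundles using (AbelianGroup; Group)
import Algebra.Properties.AbelianGroup as AbelianGroupProperties
import Algebra.Properties.CommutativeMonoid.Sum as CommutativeMonoidSum
import Algebra.Properties.CommutativeSemigroup as CommutativeSemigroupProperties
import Algebra.Properties.Group as GroupProperties
open import Data.Bool using (Bool; true; false; not; _∧_; _xor_)
import Data.Bool.Properties as Bool
open import Data.Fin using (Fin; zero; suc; splitAt; join; _↑ˡ_; _↑ʳ_)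
open import Data.Fin.Permutation as Perm using (Permutation′; _⟨$⟩ˡ_; _⟨$⟩ʳ_; _∘ₚ_)
open import Data.Fin.Properties using (+↔⊎; splitAt-join; join-splitAt)
open import Data.Nat using (ℕ; zero; suc; pred; _+_; _*_; _∸_; _^_; _≤_; z≤n; s≤s)
open import Data.Nat.DivMod using (_%_; _/_; m%n<n; m≡m%n+[m/n]*n)
open import Data.Nat.Divisibility using (_∣_; ∣-refl; ∣m∣n⇒∣m+n; ∣m+n∣m⇒∣n; _∣0; ∣1⇒≡1)
open import Data.Nat.GeneralisedArithmetic using (fold)
import Data.Nat.Properties as ℕ
open import Data.Nat.Tactic.RingSolver using (solve-∀)
open import Data.Product using (Σ-syntax; ∃; ∃!; ∃-syntax; ∃₂; _×_; _,_; proj₁; proj₂)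
open import Data.Sum as Sum using (_⊎_; inj₁; inj₂; [_,_]′)
open import Data.Sum.Function.Propositional using (_⊎-↔_)
open import Data.Vec using (Vec; []; _∷_; _++_; head; tail; take; drop; lookup; map; tabulate; zipWith; _[_]≔_)
open import Data.Vec.Properties using (≡-dec; ∷-injectiveˡ; ∷-injectiveʳ; ++-injective; map-id; map-const; zipWith-assoc; zipWith-comm; zipWith-identityˡ; zipWith-identityʳ; zipWith-++; take-zipWith; drop-zipWith; take++drop≡id; tabulate∘lookup; lookup∘tabulate; tabulate-cong; lookup-splitAt)
open import Data.Vec.Relation.Unary.All using (All; []; _∷_)
import Data.Vec.Relation.Unary.All.Properties as All
open import Function using (_∘_; id; const; _↔_; _⤖_; Inverse; Bijection; mk↔ₛ′)
open import Function.Construct.Composition using (_↔-∘_)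
open import Function.Construct.Symmetry using (↔-sym)
open import Function.Properties.Inverse using (↔⇒⤖)
open import Level using (0ℓ)
open import Relation.Binary.PropositionalEquality using (_≡_; refl; sym; trans; cong; cong₂; subst; subst₂; setoid; isEquivalence; module ≡-Reasoning)
open import Relation.Nullary using (Dec; yes; no; contradiction; map′; _×-dec_; _⊎-dec_; _→-dec_; from-yes)
open import Relation.Unary using (Pred; Decidable; _⊆_; _≐_)

-- Coordinates are indexed by vectors, so an affine permutation of them acts on a syndrome by moving
-- each summand. In an even word the translation parts cancel in pairs and only the linear part
-- `L a` remains; adding a word of syndrome a restores the translation. This is why the permutations
-- of `F r` are taken affine.
--
-- Evenness of the two halves costs two dimensions in both the span and the kernel; the remaining
-- loss is a codimension in `F (r + r)`. The extremes are 0 for the span of the graph and r + r for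
-- the periods. The blocks of dimension 3 and 5 reach both; each of the two blocks of dimension 4
-- misses one of them by exactly one. Both codimensions add under products and `block₃` contributes
-- its extremes 0 and 6, so the defect of the starting block persists through its residue class
-- modulo 3.
--
-- The examples are verified by evaluating decision procedures, so conditions are brought into forms
-- with few quantifiers: spanning is tested by duality, and a period is determined by its first
-- component because τ fixes 𝟎.

private
  variable
    m n d k r s : ℕ

-- The group F n

⊕-self : (x : F n) → x ⊕ x ≡ 𝟎
⊕-self []      = refl
⊕-self (b ∷ x) = cong₂ _∷_ (Bool.xor-same b) (⊕-self x)

⊕-𝟎-abelianGroup : ℕ → AbelianGroup 0ℓ 0ℓ
⊕-𝟎-abelianGroup n = record
  { Carrier = F n
  ; _≈_ = _≡_
  ; _∙_ = _⊕_
  ; ε = 𝟎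
  ; _⁻¹ = id
  ; isAbelianGroup = record
    { isGroup = record
      { isMonoid = record
        { isSemigroup = record
          { isMagma = record { isEquivalence = isEquivalence ; ∙-cong = cong₂ _⊕_ }
          ; assoc = zipWith-assoc Bool.xor-assoc
          }
        ; identity = zipWith-identityˡ Bool.xor-identityˡ , zipWith-identityʳ Bool.xor-identityʳ
        }
      ; inverse = ⊕-self , ⊕-self
      ; ⁻¹-cong = id
      }
    ; comm = zipWith-comm Bool.xor-comm
    }
  }

module _ {n : ℕ} where
  open AbelianGroup (⊕-𝟎-abelianGroup n) public
    using () renaming (assoc to ⊕-assoc; comm to ⊕-comm; identityˡ to ⊕-identityˡ; identityʳ to ⊕-identityʳ)
  open AbelianGroupProperties (⊕-𝟎-abelianGroup n) public
    using () renaming (inverseˡ-unique to ⊕≡𝟎⇒≡; \\-leftDividesʳ to x⊕[x⊕y]≡y; ∙-cancelˡ to ⊕-cancelˡ)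
  open CommutativeSemigroupProperties (AbelianGroup.commutativeSemigroup (⊕-𝟎-abelianGroup n)) public
    using () renaming (interchange to ⊕-interchange; x∙yz≈y∙xz to x⊕yz≡y⊕xz)

true• : (x : F n) → true • x ≡ x
true• = map-id

false• : (x : F n) → false • x ≡ 𝟎
false• x = map-const x false

•-distribʳ-⊕ : (b c : Bool) (x : F n) → (b xor c) • x ≡ b • x ⊕ c • x
•-distribʳ-⊕ b c []      = refl
•-distribʳ-⊕ b c (a ∷ x) = cong₂ _∷_ (Bool.∧-distribʳ-xor a b c) (•-distribʳ-⊕ b c x)

𝟎++𝟎 : ∀ m → 𝟎 {m} ++ 𝟎 {n} ≡ 𝟎
𝟎++𝟎 zero    = refl
𝟎++𝟎 (suc m) = cong (false ∷_) (𝟎++𝟎 m)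

-- Linear maps

Additive : (F m → F n) → Set
Additive f = ∀ x y → f (x ⊕ y) ≡ f x ⊕ f y

additive-𝟎 : {f : F m → F n} → Additive f → f 𝟎 ≡ 𝟎
additive-𝟎 {f = f} f-⊕ = trans (cong f (sym (⊕-self 𝟎))) (trans (f-⊕ 𝟎 𝟎) (⊕-self _))

additive-• : {f : F m → F n} → Additive f → ∀ b x → f (b • x) ≡ b • f x
additive-• {f = f} f-⊕ true  x = trans (cong f (true• x)) (sym (true• (f x)))
additive-• {f = f} f-⊕ false x = trans (cong f (false• x)) (trans (additive-𝟎 f-⊕) (sym (false• (f x))))

lincomb-additive : (vs : Vec (F n) d) → Additive (λ c → lincomb c vs)
lincomb-additive []       []      []        = sym (⊕-self 𝟎)
lincomb-additive (v ∷ vs) (b ∷ x) (c ∷ y) = trans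
  (cong₂ _⊕_ (•-distribʳ-⊕ b c v) (lincomb-additive vs x y))
  (⊕-interchange (b • v) (c • v) _ _)

lincomb-map : {f : F m → F n} → Additive f → (c : F d) (vs : Vec (F m) d) → lincomb c (map f vs) ≡ f (lincomb c vs)
lincomb-map f-⊕ []      []       = sym (additive-𝟎 f-⊕)
lincomb-map {f = f} f-⊕ (b ∷ c) (v ∷ vs) =
  trans (cong₂ _⊕_ (sym (additive-• f-⊕ b v)) (lincomb-map f-⊕ c vs)) (sym (f-⊕ (b • v) _))

lincomb-𝟎 : (vs : Vec (F n) d) → lincomb 𝟎 vs ≡ 𝟎
lincomb-𝟎 vs = additive-𝟎 {f = λ c → lincomb c vs} (lincomb-additive vs)

lincomb-unit : (f : Fin d → F n) (i : Fin d) → lincomb (𝟎 [ i ]≔ true) (tabulate f) ≡ f i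
lincomb-unit f zero    = trans (cong₂ _⊕_ (true• (f zero)) (lincomb-𝟎 (tabulate (f ∘ suc)))) (⊕-identityʳ _)
lincomb-unit f (suc i) = trans (cong₂ _⊕_ (false• (f zero)) (lincomb-unit (f ∘ suc) i)) (⊕-identityˡ _)

-- The translation `a` enters once for each term, so only the parity of the number of terms
-- survives.
lincomb-affine : (a : F n) {g : F m → F n} → Additive g → (f : Fin d → F m) (c : F d) →
                 lincomb c (tabulate λ i → a ⊕ g (f i)) ≡ parity c • a ⊕ g (lincomb c (tabulate f))
lincomb-affine a g-⊕ f [] = sym (trans (cong₂ _⊕_ (false• a) (additive-𝟎 g-⊕)) (⊕-self 𝟎))
lincomb-affine a {g} g-⊕ f (b ∷ c) = begin
  b • (a ⊕ g v) ⊕ lincomb c (tabulate λ i → a ⊕ g (f (suc i)))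
    ≡⟨ cong₂ _⊕_ (additive-•-⊕ b) (lincomb-affine a g-⊕ (f ∘ suc) c) ⟩
  (b • a ⊕ g (b • v)) ⊕ (parity c • a ⊕ g w)
    ≡⟨ ⊕-interchange (b • a) _ _ _ ⟩
  (b • a ⊕ parity c • a) ⊕ (g (b • v) ⊕ g w)
    ≡⟨ cong₂ _⊕_ (•-distribʳ-⊕ b (parity c) a) (g-⊕ (b • v) w) ⟨
  (b xor parity c) • a ⊕ g (b • v ⊕ w) ∎
  where
  open ≡-Reasoning
  v = f zero
  w = lincomb c (tabulate (f ∘ suc))
  additive-•-⊕ : ∀ b → b • (a ⊕ g v) ≡ b • a ⊕ g (b • v)
  additive-•-⊕ true  = trans (true• _) (sym (cong₂ _⊕_ (true• a) (cong g (true• v))))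
  additive-•-⊕ false = trans (false• _) (sym (trans (cong₂ _⊕_ (false• a) (trans (cong g (false• v)) (additive-𝟎 g-⊕))) (⊕-self 𝟎)))

module _ {n : ℕ} where
  open AbelianGroup (⊕-𝟎-abelianGroup n) using (commutativeMonoid)
  open CommutativeMonoidSum commutativeMonoid using (sum; sum-permute; sum-cong-≗)

  -- Passing to a library sum makes reindexing by `sum-permute` available.
  lincomb-sum : (c : F d) (f : Fin d → F n) → lincomb c (tabulate f) ≡ sum (λ i → lookup c i • f i)
  lincomb-sum []      f = refl
  lincomb-sum (b ∷ c) f = cong (b • f zero ⊕_) (lincomb-sum c (f ∘ suc))

  lincomb-permute : (π : Permutation′ d) (c : F d) (f : Fin d → F n) →
                    lincomb (permute π c) (tabulate f) ≡ lincomb c (tabulate λ i → f (π ⟨$⟩ʳ i))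
  lincomb-permute π c f = begin
    lincomb (permute π c) (tabulate f)
      ≡⟨ lincomb-sum (permute π c) f ⟩
    sum (λ i → lookup (permute π c) i • f i)
      ≡⟨ sum-permute _ π ⟩
    sum (λ i → lookup (permute π c) (π ⟨$⟩ʳ i) • f (π ⟨$⟩ʳ i))
      ≡⟨ sum-cong-≗ (λ i → cong (_• f (π ⟨$⟩ʳ i)) (trans (lookup∘tabulate _ (π ⟨$⟩ʳ i)) (cong (lookup c) (Perm.inverseˡ π)))) ⟩
    sum (λ i → lookup c i • f (π ⟨$⟩ʳ i))
      ≡⟨ lincomb-sum c _ ⟨
    lincomb c (tabulate λ i → f (π ⟨$⟩ʳ i)) ∎
    where open ≡-Reasoning

-- Parity as a combination of equal vectors of length one inherits additivity and permutation
-- invariance from `lincomb`.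
parity-lincomb : (c : F n) → lincomb c (tabulate λ _ → true ∷ []) ≡ parity c ∷ []
parity-lincomb []      = refl
parity-lincomb (b ∷ c) = cong₂ _⊕_ (cong (_∷ []) (Bool.∧-identityʳ b)) (parity-lincomb c)

parity-⊕ : (x y : F n) → parity (x ⊕ y) ≡ parity x xor parity y
parity-⊕ x y = ∷-injectiveˡ (begin
  parity (x ⊕ y) ∷ []               ≡⟨ parity-lincomb (x ⊕ y) ⟨
  lincomb (x ⊕ y) _                 ≡⟨ lincomb-additive _ x y ⟩
  lincomb x _ ⊕ lincomb y _         ≡⟨ cong₂ _⊕_ (parity-lincomb x) (parity-lincomb y) ⟩
  (parity x xor parity y) ∷ []      ∎)
  where open ≡-Reasoning

parity-unit : (i : Fin n) → parity (𝟎 [ i ]≔ true) ≡ true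
parity-unit i = ∷-injectiveˡ (trans (sym (parity-lincomb (𝟎 [ i ]≔ true))) (lincomb-unit _ i))

parity-𝟎 : ∀ n → parity (𝟎 {n}) ≡ false
parity-𝟎 zero    = refl
parity-𝟎 (suc n) = parity-𝟎 n

parity-permute : (π : Permutation′ n) (x : F n) → parity (permute π x) ≡ parity x
parity-permute π x = ∷-injectiveˡ (begin
  parity (permute π x) ∷ []   ≡⟨ parity-lincomb (permute π x) ⟨
  lincomb (permute π x) _     ≡⟨ lincomb-permute π x _ ⟩
  lincomb x _                 ≡⟨ parity-lincomb x ⟩
  parity x ∷ []               ∎)
  where open ≡-Reasoning

-- Dimensions

-- An injective linear map onto `V` stands in for a basis: such maps compose and restrict without
-- handling lists of vectors, and a basis is read off only at the end.
record Parametrization (V : Code n) (d : ℕ) : Set where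
  field
    param     : F d → F n
    additive  : Additive param
    injective : ∀ c → param c ≡ 𝟎 → c ≡ 𝟎
    range     : V ≐ λ x → ∃[ c ] param c ≡ x

-- For additive `f` these are the columns of its matrix, the images of the standard unit vectors.
basis : (F d → F n) → Vec (F n) d
basis {zero}  f = []
basis {suc d} f = f (true ∷ 𝟎) ∷ basis (f ∘ (false ∷_))

lincomb-basis : {f : F d → F n} → Additive f → ∀ c → lincomb c (basis f) ≡ f c
lincomb-basis f-⊕ [] = sym (additive-𝟎 f-⊕)
lincomb-basis {f = f} f-⊕ (b ∷ c) = begin
  b • f (true ∷ 𝟎) ⊕ lincomb c (basis (f ∘ (false ∷_)))
    ≡⟨ cong₂ _⊕_ (sym (additive-• f-⊕ b (true ∷ 𝟎))) (lincomb-basis (λ x y → f-⊕ (false ∷ x) (false ∷ y)) c) ⟩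
  f (b • (true ∷ 𝟎)) ⊕ f (false ∷ c)
    ≡⟨ f-⊕ (b • (true ∷ 𝟎)) (false ∷ c) ⟨
  f (b • (true ∷ 𝟎) ⊕ (false ∷ c))
    ≡⟨ cong f (cong₂ _∷_ (trans (Bool.xor-identityʳ _) (Bool.∧-identityʳ b)) (b•𝟎⊕ b)) ⟩
  f (b ∷ c) ∎
  where
  open ≡-Reasoning
  b•𝟎⊕ : ∀ b → b • 𝟎 ⊕ c ≡ c
  b•𝟎⊕ true  = trans (cong (_⊕ c) (true• 𝟎)) (⊕-identityˡ c)
  b•𝟎⊕ false = trans (cong (_⊕ c) (false• 𝟎)) (⊕-identityˡ c)

parametrization⇒dimension : {V : Code n} → Parametrization V d → HasDimension V d
parametrization⇒dimension P =
    basis param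
  , (λ c eq → injective c (trans (sym (lincomb-basis additive c)) eq))
  , (λ x∈V → let c , eq = proj₁ range x∈V in c , trans (lincomb-basis additive c) eq)
  , (λ (c , eq) → proj₂ range (c , trans (sym (lincomb-basis additive c)) eq))
  where open Parametrization P

Functional : (F n → Bool) → Set
Functional f = ∀ x y → f (x ⊕ y) ≡ f x xor f y

functional-𝟎 : {f : F n → Bool} → Functional f → f 𝟎 ≡ false
functional-𝟎 {f = f} f-⊕ = trans (cong f (sym (⊕-self 𝟎))) (trans (f-⊕ 𝟎 𝟎) (Bool.xor-same (f 𝟎)))

-- One step of Gaussian elimination. If `f` is nonzero on the first unit vector, the first
-- coordinate of a solution is determined by the others; if not, `f` ignores that coordinate and the
-- search for a pivot continues. The witness `x` guarantees that it ends.
hyperplane : {f : F d → Bool} → Functional f → ∀ x → f x ≡ true →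
             Parametrization (λ y → f y ≡ false) (pred d)
hyperplane {f = f} f-⊕ [] fx = contradiction (trans (sym fx) (functional-𝟎 {f = f} f-⊕)) λ ()
hyperplane {suc d} {f = f} f-⊕ (b ∷ x) fx with f (true ∷ 𝟎) in f1
... | true = record
  { param     = λ c → g c ∷ c
  ; additive  = λ c c′ → cong (_∷ _) (g-⊕ c c′)
  ; injective = λ _ → ∷-injectiveʳ
  ; range     = (λ { {b ∷ c} eq → c , cong (_∷ c) (g-false b c eq) })
              , λ { (c , refl) → f-g c }
  }
  where
  g : F d → Bool
  g c = f (false ∷ c)
  g-⊕ : Functional g
  g-⊕ c c′ = f-⊕ (false ∷ c) (false ∷ c′)
  f-true : ∀ c → f (true ∷ c) ≡ true xor g c
  f-true c = trans (cong (f ∘ (true ∷_)) (sym (⊕-identityˡ c)))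
                   (trans (f-⊕ (true ∷ 𝟎) (false ∷ c)) (cong (_xor g c) f1))
  g-false : ∀ b c → f (b ∷ c) ≡ false → g c ≡ b
  g-false false c eq = eq
  g-false true  c eq with g c | f-true c
  ... | true  | _  = refl
  ... | false | f≡ = contradiction (trans (sym f≡) eq) λ ()
  f-g : ∀ c → f (g c ∷ c) ≡ false
  f-g c with g c in eq
  ... | false = eq
  ... | true  = trans (f-true c) (cong (true xor_) eq)
-- Length one is split off so that `pred` reduces in the recursive clause; a vanishing `f`
-- contradicts the witness here.
hyperplane {suc zero} {f = f} f-⊕ (b ∷ []) fx | false = contradiction (trans (sym fx) (f≡false b)) λ ()
  where
  f≡false : ∀ b → f (b ∷ []) ≡ false
  f≡false true  = f1
  f≡false false = functional-𝟎 {f = f} f-⊕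
hyperplane {suc (suc d)} {f = f} f-⊕ (b ∷ x) fx | false = record
  { param     = λ { (b ∷ c) → b ∷ param c }
  ; additive  = λ { (_ ∷ c) (_ ∷ c′) → cong (_ ∷_) (additive c c′) }
  ; injective = λ { (b ∷ c) eq → cong₂ _∷_ (∷-injectiveˡ eq) (injective c (∷-injectiveʳ eq)) }
  ; range     = (λ { {b ∷ y} eq → let c , p = proj₁ range (trans (sym (f-∷ b y)) eq) in b ∷ c , cong (b ∷_) p })
              , λ { (b ∷ c , refl) → trans (f-∷ b (param c)) (proj₂ range (c , refl)) }
  }
  where
  f-∷ : ∀ b y → f (b ∷ y) ≡ f (false ∷ y)
  f-∷ false y = refl
  f-∷ true  y = trans (cong (f ∘ (true ∷_)) (sym (⊕-identityˡ y)))
                      (trans (f-⊕ (true ∷ 𝟎) (false ∷ y)) (cong (_xor f (false ∷ y)) f1))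
  open Parametrization (hyperplane {f = f ∘ (false ∷_)} (λ y z → f-⊕ (false ∷ y) (false ∷ z)) x (trans (sym (f-∷ b x)) fx))

cut : {V : Code n} → Parametrization V d → {f : F n → Bool} → Functional f →
      ∀ x → V x → f x ≡ true → Parametrization (λ y → V y × f y ≡ false) (pred d)
cut P {f} f-⊕ x x∈V fx = record
  { param     = P.param ∘ H.param
  ; additive  = λ c c′ → trans (cong P.param (H.additive c c′)) (P.additive _ _)
  ; injective = λ c eq → H.injective c (P.injective _ eq)
  ; range     = (λ { (y∈V , fy) → let c , p = proj₁ P.range y∈V
                                      c′ , q = proj₁ H.range (trans (cong f p) fy)
                                  in c′ , trans (cong P.param q) p })
              , λ { (c , refl) → proj₂ P.range (_ , refl) , proj₂ H.range (c , refl) }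
  }
  where
  module P = Parametrization P
  module H = Parametrization (hyperplane {f = f ∘ P.param}
    (λ c c′ → trans (cong f (P.additive c c′)) (f-⊕ _ _))
    (proj₁ (proj₁ P.range x∈V)) (trans (cong f (proj₂ (proj₁ P.range x∈V))) fx))

Parametrization-resp-≐ : {V W : Code n} → V ≐ W → Parametrization V d → Parametrization W d
Parametrization-resp-≐ (V⊆W , W⊆V) P = record
  { param = param ; additive = additive ; injective = injective
  ; range = (λ x∈W → proj₁ range (W⊆V x∈W)) , (λ x → V⊆W (proj₂ range x))
  }
  where open Parametrization P

-- Rank and nullity, one coordinate of `φ` at a time. Surjectivity yields a vector killed by the
-- other coordinates but not by the current one, so each cut lowers the dimension by exactly one.
kernel-parametrization : {φ : F n → F k} → Additive φ → (∀ y → ∃[ x ] φ x ≡ y) →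
                         Parametrization (λ x → φ x ≡ 𝟎) (n ∸ k)
kernel-parametrization {k = zero} {φ} φ-⊕ surj = record
  { param     = id
  ; additive  = λ _ _ → refl
  ; injective = λ _ → id
  ; range     = (λ {x} _ → x , refl) , λ {x} _ → F0 (φ x)
  }
  where
  F0 : (y : F 0) → y ≡ []
  F0 [] = refl
kernel-parametrization {n} {suc k} {φ} φ-⊕ surj =
  subst (Parametrization _) (ℕ.pred[m∸n]≡m∸[1+n] n k)
    (Parametrization-resp-≐
      ( (λ {x} (t , h) → trans (η (φ x)) (cong₂ _∷_ h t))
      , (λ {x} eq → cong tail eq , cong head eq) )
      (cut (kernel-parametrization {φ = tail ∘ φ} (λ x y → trans (cong tail (φ-⊕ x y)) (tail-⊕ (φ x) (φ y)))
             (λ y → let x , eq = surj (false ∷ y) in x , cong tail eq))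
           {head ∘ φ} (λ x y → trans (cong head (φ-⊕ x y)) (head-⊕ (φ x) (φ y)))
           (proj₁ (surj (true ∷ 𝟎))) (cong tail (proj₂ (surj (true ∷ 𝟎)))) (cong head (proj₂ (surj (true ∷ 𝟎))))))
  where
  η : (y : F (suc m)) → y ≡ head y ∷ tail y
  η (_ ∷ _) = refl
  head-⊕ : (x y : F (suc m)) → head (x ⊕ y) ≡ head x xor head y
  head-⊕ (_ ∷ _) (_ ∷ _) = refl
  tail-⊕ : (x y : F (suc m)) → tail (x ⊕ y) ≡ tail x ⊕ tail y
  tail-⊕ (_ ∷ _) (_ ∷ _) = refl

-- Spans

lincomb-++ : (b : F k) (c : F d) (us : Vec (F n) k) (vs : Vec (F n) d) →
             lincomb (b ++ c) (us ++ vs) ≡ lincomb b us ⊕ lincomb c vs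
lincomb-++ []      c []       vs = sym (⊕-identityˡ _)
lincomb-++ (a ∷ b) c (u ∷ us) vs = trans (cong (a • u ⊕_) (lincomb-++ b c us vs)) (sym (⊕-assoc _ _ _))

span-𝟎 : {C : Code n} → span C 𝟎
span-𝟎 = 0 , [] , [] , [] , refl

span-⊕ : {C : Code n} {x y : F n} → span C x → span C y → span C (x ⊕ y)
span-⊕ (_ , us , us∈C , b , p) (_ , vs , vs∈C , c , q) =
  _ , us ++ vs , All.++⁺ us∈C vs∈C , b ++ c , trans (lincomb-++ b c us vs) (cong₂ _⊕_ p q)

⊆-span : {C : Code n} → C ⊆ span C
⊆-span {x = x} x∈C = 1 , x ∷ [] , x∈C ∷ [] , true ∷ [] , trans (⊕-identityʳ _) (true• x)

span-least : {C V : Code n} → V 𝟎 → (∀ {x y} → V x → V y → V (x ⊕ y)) → C ⊆ V → span C ⊆ V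
span-least {C = C} {V} V𝟎 V⊕ C⊆V (_ , vs , vs∈C , c , refl) = go c vs∈C
  where
  go : ∀ {k} (c : F k) {vs : Vec _ k} → All C vs → V (lincomb c vs)
  go []          []           = V𝟎
  go (true ∷ c)  (v∈C ∷ vs∈C) = V⊕ (subst V (sym (true• _)) (C⊆V v∈C)) (go c vs∈C)
  go (false ∷ c) (v∈C ∷ vs∈C) = V⊕ (subst V (sym (false• _)) V𝟎) (go c vs∈C)

-- Linear functionals and duality

dot : F n → F n → Bool
dot u x = parity (zipWith _∧_ u x)

dot-⊕ : (u : F n) → Functional (dot u)
dot-⊕ []      []      []      = refl
dot-⊕ (a ∷ u) (b ∷ x) (c ∷ y) = begin
  (a ∧ (b xor c)) xor dot u (x ⊕ y)                 ≡⟨ cong₂ _xor_ (Bool.∧-distribˡ-xor a b c) (dot-⊕ u x y) ⟩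
  (a ∧ b xor a ∧ c) xor (dot u x xor dot u y)       ≡⟨ xor-interchange (a ∧ b) (a ∧ c) (dot u x) (dot u y) ⟩
  (a ∧ b xor dot u x) xor (a ∧ c xor dot u y)       ∎
  where
  open ≡-Reasoning
  xor-interchange : ∀ a b c d → (a xor b) xor (c xor d) ≡ (a xor c) xor (b xor d)
  xor-interchange a b c d = ∷-injectiveˡ (⊕-interchange (a ∷ []) (b ∷ []) (c ∷ []) (d ∷ []))

-- Induction on the length: the first coordinate functional is detected by some `true ∷ w`, and the
-- hypothesis passes to the slice of vectors with first coordinate zero. No decidability of `V`
-- enters, so spans are admissible.
separating⇒full : (V : Code n) → V 𝟎 → (∀ {x y} → V x → V y → V (x ⊕ y)) →
                  (∀ u → u ≡ 𝟎 ⊎ ∃[ v ] (V v × dot u v ≡ true)) → ∀ x → V x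
separating⇒full V V𝟎 V⊕ sep [] = V𝟎
separating⇒full {suc n} V V𝟎 V⊕ sep (b ∷ x) with sep (true ∷ 𝟎)
... | inj₁ ()
... | inj₂ (false ∷ w , _ , eq) = contradiction (trans (sym eq) (dot-𝟎 w)) λ ()
  where
  dot-𝟎 : (w : F m) → dot 𝟎 w ≡ false
  dot-𝟎 []      = refl
  dot-𝟎 (_ ∷ w) = dot-𝟎 w
... | inj₂ (true ∷ w , V1w , _) = lift b
  where
  V′ : Code n
  V′ y = V (false ∷ y)
  sep′ : ∀ u → u ≡ 𝟎 ⊎ ∃[ v ] (V′ v × dot u v ≡ true)
  -- The added coordinate makes the functional vanish on `true ∷ w`, so a detecting vector can be
  -- moved into the slice by adding `true ∷ w`.
  sep′ u with sep (dot u w ∷ u)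
  ... | inj₁ eq = inj₁ (∷-injectiveʳ eq)
  ... | inj₂ (false ∷ v , Vv , eq) = inj₂ (v , Vv , trans (cong (_xor dot u v) (sym (Bool.∧-zeroʳ (dot u w)))) eq)
  ... | inj₂ (true ∷ v , Vv , eq) = inj₂ (w ⊕ v , V⊕ V1w Vv
    , trans (dot-⊕ u w v) (trans (cong (_xor dot u v) (sym (Bool.∧-identityʳ (dot u w)))) eq))
  full : ∀ y → V′ y
  full = separating⇒full V′ V𝟎 V⊕ sep′
  lift : ∀ b → V (b ∷ x)
  lift false = full x
  lift true  = subst (V ∘ (true ∷_)) (x⊕[x⊕y]≡y w x) (V⊕ V1w (full (w ⊕ x)))

-- Halves and parities of words

take-++ : (x : F m) (y : F n) → take m (x ++ y) ≡ x
take-++ {m} x y = proj₁ (++-injective (take m (x ++ y)) x (take++drop≡id m (x ++ y)))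

drop-++ : (x : F m) (y : F n) → drop m (x ++ y) ≡ y
drop-++ {m} x y = proj₂ (++-injective (take m (x ++ y)) x (take++drop≡id m (x ++ y)))

take-⊕ : ∀ m (x y : F (m + n)) → take m (x ⊕ y) ≡ take m x ⊕ take m y
take-⊕ m = take-zipWith _xor_

drop-⊕ : ∀ m (x y : F (m + n)) → drop m (x ⊕ y) ≡ drop m x ⊕ drop m y
drop-⊕ m = drop-zipWith {m = m} _xor_

-- The odd case is carried along because a leading one exchanges the two cases.
parity⇒2∣wt : (x : F n) → (parity x ≡ false → 2 ∣ wt x) × (parity x ≡ true → 2 ∣ suc (wt x))
parity⇒2∣wt []          = (λ _ → 2 ∣0) , λ ()
parity⇒2∣wt (false ∷ x) = parity⇒2∣wt x
parity⇒2∣wt (true ∷ x) with parity x | parity⇒2∣wt x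
... | true  | _ , odd  = (λ _ → odd refl) , λ ()
... | false | even , _ = (λ ()) , λ _ → ∣m∣n⇒∣m+n ∣-refl (even refl)

2∣wt⇒parity : (x : F n) → 2 ∣ wt x → parity x ≡ false
2∣wt⇒parity x 2∣wt with parity x in eq
... | false = refl
... | true  = contradiction (∣1⇒≡1 (∣m+n∣m⇒∣n (subst (2 ∣_) (ℕ.+-comm 1 _) (proj₂ (parity⇒2∣wt x) eq)) 2∣wt)) λ ()

-- Syndromes

module Words (r : ℕ) where
  open Inverse (coordinates r) renaming (to to vectorAt; from to positionOf)

  vectorAt∘positionOf : ∀ a → vectorAt (positionOf a) ≡ a
  vectorAt∘positionOf = Inverse.strictlyInverseˡ (coordinates r)

  syndrome : F (2 ^ r) → F r
  syndrome c = lincomb c (tabulate vectorAt)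

  syndrome-⊕ : Additive syndrome
  syndrome-⊕ = lincomb-additive (tabulate vectorAt)

  syndrome-e : ∀ a → syndrome (e a) ≡ a
  syndrome-e a = trans (lincomb-unit vectorAt (positionOf a)) (vectorAt∘positionOf a)

  parity-e : (a : F r) → parity (e a) ≡ true
  parity-e a = parity-unit (positionOf a)

  -- The position of 𝟎 contributes nothing to a syndrome, so `e 𝟎` adjusts the parity alone; parity
  -- and syndrome can thus be prescribed independently.
  word : Bool → F r → F (2 ^ r)
  word true  a = e a
  word false a = e a ⊕ e {r} 𝟎

  parity-word : ∀ b a → parity (word b a) ≡ b
  parity-word true  a = parity-e a
  parity-word false a = trans (parity-⊕ (e a) (e {r} 𝟎)) (cong₂ _xor_ (parity-e a) (parity-e 𝟎))

  syndrome-word : ∀ b a → syndrome (word b a) ≡ a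
  syndrome-word true  a = syndrome-e a
  syndrome-word false a = trans (syndrome-⊕ (e a) (e {r} 𝟎)) (trans (cong₂ _⊕_ (syndrome-e a) (syndrome-e 𝟎)) (⊕-identityʳ a))

  ℋ⇒ : {x : F (2 ^ r)} → ℋ x → parity x ≡ false × syndrome x ≡ 𝟎
  ℋ⇒ {x} (syn , even) = 2∣wt⇒parity x even , syn

  ℋ[]⇒ : ∀ {a x} → ℋ[ a ] x → parity x ≡ false × syndrome x ≡ a
  ℋ[]⇒ {a} (h , h∈ℋ , refl) =
      trans (parity-⊕ (word false a) h) (cong₂ _xor_ (parity-word false a) (proj₁ (ℋ⇒ {h} h∈ℋ)))
    , trans (syndrome-⊕ (word false a) h) (trans (cong₂ _⊕_ (syndrome-word false a) (proj₂ (ℋ⇒ {h} h∈ℋ))) (⊕-identityʳ a))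

  ⇒ℋ[] : ∀ {a x} → parity x ≡ false → syndrome x ≡ a → ℋ[ a ] x
  ⇒ℋ[] {a} {x} even syn = word false a ⊕ x
    , ( trans (syndrome-⊕ (word false a) x) (trans (cong₂ _⊕_ (syndrome-word false a) syn) (⊕-self a))
      , proj₁ (parity⇒2∣wt (word false a ⊕ x)) (trans (parity-⊕ (word false a) x) (cong₂ _xor_ (parity-word false a) even)) )
    , x⊕[x⊕y]≡y (word false a) x

  left right : F (2 ^ r + 2 ^ r) → F (2 ^ r)
  left  = take (2 ^ r)
  right = drop (2 ^ r)

  parityˡ parityʳ : F (2 ^ r + 2 ^ r) → Bool
  parityˡ = parity ∘ left
  parityʳ = parity ∘ right

  parityˡ-⊕ : Functional parityˡ
  parityˡ-⊕ v w = trans (cong parity (take-⊕ (2 ^ r) v w)) (parity-⊕ (left v) (left w))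

  parityʳ-⊕ : Functional parityʳ
  parityʳ-⊕ v w = trans (cong parity (drop-⊕ (2 ^ r) v w)) (parity-⊕ (right v) (right w))

  syndromeˡ syndromeʳ : F (2 ^ r + 2 ^ r) → F r
  syndromeˡ = syndrome ∘ left
  syndromeʳ = syndrome ∘ right

  syndromeˡ-⊕ : Additive syndromeˡ
  syndromeˡ-⊕ v w = trans (cong syndrome (take-⊕ (2 ^ r) v w)) (syndrome-⊕ (left v) (left w))

  syndromeʳ-⊕ : Additive syndromeʳ
  syndromeʳ-⊕ v w = trans (cong syndrome (drop-⊕ (2 ^ r) v w)) (syndrome-⊕ (right v) (right w))

  module _ (b c : Bool) (x y : F r) where
    words : F (2 ^ r + 2 ^ r)
    words = word b x ++ word c y

    parityˡ-words : parityˡ words ≡ b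
    parityˡ-words = trans (cong parity (take-++ (word b x) (word c y))) (parity-word b x)

    parityʳ-words : parityʳ words ≡ c
    parityʳ-words = trans (cong parity (drop-++ (word b x) (word c y))) (parity-word c y)

    syndromeˡ-words : syndromeˡ words ≡ x
    syndromeˡ-words = trans (cong syndrome (take-++ (word b x) (word c y))) (syndrome-word b x)

    syndromeʳ-words : syndromeʳ words ≡ y
    syndromeʳ-words = trans (cong syndrome (drop-++ (word b x) (word c y))) (syndrome-word c y)

  -- Common shape of the code, its span and its kernel, which differ only in the relation `P`
  -- between the two syndromes.
  record EvenWord (P : F r → F r → Set) (w : F (2 ^ r + 2 ^ r)) : Set where
    constructor evenWord
    field
      evenˡ     : parityˡ w ≡ false
      evenʳ     : parityʳ w ≡ false
      syndromes : P (syndromeˡ w) (syndromeʳ w)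

  evenWord-⊕ : ∀ {P Q R : F r → F r → Set} → (∀ {x x′ y y′} → P x y → Q x′ y′ → R (x ⊕ x′) (y ⊕ y′)) →
               ∀ {v w} → EvenWord P v → EvenWord Q w → EvenWord R (v ⊕ w)
  evenWord-⊕ {R = R} f {v} {w} (evenWord p q s) (evenWord p′ q′ s′) = evenWord
    (trans (parityˡ-⊕ v w) (cong₂ _xor_ p p′))
    (trans (parityʳ-⊕ v w) (cong₂ _xor_ q q′))
    (subst₂ R (sym (syndromeˡ-⊕ v w)) (sym (syndromeʳ-⊕ v w)) (f s s′))

  evenWord-words : ∀ {P : F r → F r → Set} {x y} → P x y → EvenWord P (words false false x y)
  evenWord-words {P} {x} {y} Pxy = evenWord
    (parityˡ-words false false x y)
    (parityʳ-words false false x y)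
    (subst₂ P (sym (syndromeˡ-words false false x y)) (sym (syndromeʳ-words false false x y)) Pxy)

  Graph : (F r → F r) → F r → F r → Set
  Graph τ x y = y ≡ τ x

  S⇒evenWord : ∀ τ {w} → S τ w → EvenWord (Graph (Bijection.to τ)) w
  S⇒evenWord τ (a , x , y , x∈ℋ , y∈ℋ , refl) with ℋ[]⇒ x∈ℋ | ℋ[]⇒ y∈ℋ
  ... | even-x , syndrome-x | even-y , syndrome-y = evenWord
    (trans (cong parity (take-++ x y)) even-x)
    (trans (cong parity (drop-++ x y)) even-y)
    (trans (cong syndrome (drop-++ x y)) (trans syndrome-y
      (cong (Bijection.to τ) (sym (trans (cong syndrome (take-++ x y)) syndrome-x)))))

  evenWord⇒S : ∀ τ {w} → EvenWord (Graph (Bijection.to τ)) w → S τ w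
  evenWord⇒S τ {w} (evenWord p q s) =
    syndromeˡ w , left w , right w , ⇒ℋ[] p refl , ⇒ℋ[] q s , take++drop≡id (2 ^ r) w

-- Rank and kernel

-- Independence of the k equations is stated as surjectivity of `lhs`, which makes the codimension
-- exactly k.
record Equations (r k : ℕ) : Set where
  open Words r
  field
    lhs         : F r → F r → F k
    additive    : ∀ x x′ y y′ → lhs (x ⊕ x′) (y ⊕ y′) ≡ lhs x y ⊕ lhs x′ y′
    independent : ∀ z → ∃₂ λ x y → lhs x y ≡ z

  Solution : F r → F r → Set
  Solution x y = lhs x y ≡ 𝟎

  private
    φ : F (2 ^ r + 2 ^ r) → F (2 + k)
    φ w = parityˡ w ∷ parityʳ w ∷ lhs (syndromeˡ w) (syndromeʳ w)

    φ-⊕ : Additive φ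
    φ-⊕ v w = cong₂ _∷_ (parityˡ-⊕ v w) (cong₂ _∷_ (parityʳ-⊕ v w)
      (trans (cong₂ lhs (syndromeˡ-⊕ v w) (syndromeʳ-⊕ v w)) (additive _ _ _ _)))

    φ-surjective : ∀ z → ∃[ w ] φ w ≡ z
    φ-surjective (b ∷ c ∷ z) with independent z
    ... | x , y , eq = words b c x y , cong₂ _∷_ (parityˡ-words b c x y) (cong₂ _∷_ (parityʳ-words b c x y)
      (trans (cong₂ lhs (syndromeˡ-words b c x y) (syndromeʳ-words b c x y)) eq))

  -- The two parities join the k equations in one surjective map, because `words` realises every
  -- choice of parities and syndromes; hence 2 + k.
  dimension : {V : Code (2 ^ r + 2 ^ r)} → V ≐ EvenWord Solution →
              HasDimension V ((2 ^ r + 2 ^ r) ∸ (2 + k))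
  dimension (V⊆ , ⊆V) = parametrization⇒dimension (Parametrization-resp-≐
    ( (λ eq → ⊆V (evenWord (∷-injectiveˡ eq) (∷-injectiveˡ (∷-injectiveʳ eq)) (∷-injectiveʳ (∷-injectiveʳ eq))))
    , (λ x∈V → let evenWord p q s = V⊆ x∈V in cong₂ _∷_ p (cong₂ _∷_ q s)) )
    (kernel-parametrization {φ = φ} φ-⊕ φ-surjective))

graph : (F r → F r) → Code (r + r)
graph τ w = ∃[ a ] a ++ τ a ≡ w

Period : (F r → F r) → F r → F r → Set
Period τ x y = ∀ z → τ (x ⊕ z) ≡ y ⊕ τ z

record RankCertificate (τ : F r → F r) (k : ℕ) : Set where
  field
    equations : Equations r k
  open Equations equations
  field
    satisfied : ∀ a → Solution a (τ a)
    complete  : ∀ x y → Solution x y → span (graph τ) (x ++ y)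

record KernelCertificate (τ : F r → F r) (k : ℕ) : Set where
  field
    equations : Equations r k
  open Equations equations
  field
    sound    : ∀ x y → Solution x y → Period τ x y
    complete : ∀ x y → Period τ x y → Solution x y

module _ {r : ℕ} (τ : F r ⤖ F r) (τ-𝟎 : Bijection.to τ 𝟎 ≡ 𝟎) where
  open Words r
  private
    t = Bijection.to τ

  𝟎∈S : S τ 𝟎
  𝟎∈S = evenWord⇒S τ (evenWord
    (functional-𝟎 {f = parityˡ} parityˡ-⊕)
    (functional-𝟎 {f = parityʳ} parityʳ-⊕)
    (trans (additive-𝟎 {f = syndromeʳ} syndromeʳ-⊕)
      (sym (trans (cong t (additive-𝟎 {f = syndromeˡ} syndromeˡ-⊕)) τ-𝟎))))

  rank-S : RankCertificate t k → HasRank (S τ) ((2 ^ r + 2 ^ r) ∸ (2 + k))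
  rank-S cert = dimension
    ( span-least (S⊆ 𝟎∈S) (evenWord-⊕ λ s s′ → trans (additive _ _ _ _) (trans (cong₂ _⊕_ s s′) (⊕-self 𝟎))) S⊆
    , λ {w} w∈ → span-least {V = Lifted} lifted-𝟎 lifted-⊕ lifted-graph (complete _ _ (EvenWord.syndromes w∈))
                   (evenWord (EvenWord.evenˡ w∈) (EvenWord.evenʳ w∈) refl) )
    where
    open RankCertificate cert
    open Equations equations
    S⊆ : S τ ⊆ EvenWord Solution
    S⊆ {w} w∈S with S⇒evenWord τ w∈S
    ... | evenWord p q s = evenWord p q (trans (cong (lhs (syndromeˡ w)) s) (satisfied (syndromeˡ w)))
    -- All even words with the given syndromes are taken at once; with a single representative, the
    -- words of zero syndromes would need a separate argument.
    Lifted : Code (r + r)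
    Lifted v = ∀ {w} → EvenWord (λ x y → x ++ y ≡ v) w → span (S τ) w
    lifted-graph : graph t ⊆ Lifted
    lifted-graph (a , refl) {w} (evenWord p q eq) with ++-injective (syndromeˡ w) a eq
    ... | eqˡ , eqʳ = ⊆-span (evenWord⇒S τ (evenWord p q (trans eqʳ (cong t (sym eqˡ)))))
    lifted-𝟎 : Lifted 𝟎
    lifted-𝟎 = lifted-graph {𝟎} (𝟎 , trans (cong (𝟎 ++_) τ-𝟎) (𝟎++𝟎 r))
    lifted-⊕ : ∀ {x y} → Lifted x → Lifted y → Lifted (x ⊕ y)
    -- Any even word `u` with syndromes `x` splits `w` into `u` and `u ⊕ w`, and the latter has
    -- syndromes `y`.
    lifted-⊕ {x} {y} x∈ y∈ {w} w∈ = subst (span (S τ)) (x⊕[x⊕y]≡y u w)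
      (span-⊕ (x∈ u∈) (y∈ (evenWord-⊕ (λ {a} {a′} {b} {b′} → u⊕w a a′ b b′) u∈ w∈)))
      where
      u = words false false (take r x) (drop r x)
      u∈ : EvenWord (λ a b → a ++ b ≡ x) u
      u∈ = evenWord-words {P = λ a b → a ++ b ≡ x} (take++drop≡id r x)
      u⊕w : (a a′ b b′ : F r) → a ++ b ≡ x → a′ ++ b′ ≡ x ⊕ y → (a ⊕ a′) ++ (b ⊕ b′) ≡ y
      u⊕w a a′ b b′ refl eq = trans (sym (zipWith-++ _xor_ a b a′ b′))
        (trans (cong ((a ++ b) ⊕_) eq) (x⊕[x⊕y]≡y (a ++ b) y))

  kernel-S : KernelCertificate t k → HasDimension (Ker (S τ)) ((2 ^ r + 2 ^ r) ∸ (2 + k))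
  kernel-S cert = dimension (Ker⊆ , ⊆Ker)
    where
    open KernelCertificate cert
    open Equations equations
    ⊕∈S : ∀ {v w} → EvenWord Solution v → S τ w → S τ (v ⊕ w)
    ⊕∈S v∈ w∈S = evenWord⇒S τ (evenWord-⊕ {Q = Graph t}
      (λ {x} {x′} {y} {y′} s s′ → trans (cong (y ⊕_) s′) (sym (sound x y s x′))) v∈ (S⇒evenWord τ w∈S))
    ⊆Ker : EvenWord Solution ⊆ Ker (S τ)
    ⊆Ker {v} v∈ = (λ { (w , w∈S , refl) → ⊕∈S v∈ w∈S })
                , (λ {w} w∈S → v ⊕ w , ⊕∈S v∈ w∈S , x⊕[x⊕y]≡y v w)
    Ker⊆ : Ker (S τ) ⊆ EvenWord Solution
    -- Translating the zero codeword shows that `v` is itself a codeword, hence even in both halves;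
    -- translating words with syndromes z and `t z` then yields the period.
    Ker⊆ {v} (vS⊆S , _) with S⇒evenWord τ (subst (S τ) (⊕-identityʳ v) (vS⊆S (𝟎 , 𝟎∈S , refl)))
    ... | evenWord p q _ = evenWord p q (complete _ _ period)
      where
      period : Period t (syndromeˡ v) (syndromeʳ v)
      period z = begin
        t (syndromeˡ v ⊕ z)             ≡⟨ cong (λ z → t (syndromeˡ v ⊕ z)) (syndromeˡ-words false false z (t z)) ⟨
        t (syndromeˡ v ⊕ syndromeˡ w)   ≡⟨ cong t (syndromeˡ-⊕ v w) ⟨
        t (syndromeˡ (v ⊕ w))           ≡⟨ EvenWord.syndromes (S⇒evenWord τ (vS⊆S (w , evenWord⇒S τ (evenWord-words {P = Graph t} refl) , refl))) ⟨
        syndromeʳ (v ⊕ w)               ≡⟨ syndromeʳ-⊕ v w ⟩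
        syndromeʳ v ⊕ syndromeʳ w       ≡⟨ cong (syndromeʳ v ⊕_) (syndromeʳ-words false false z (t z)) ⟩
        syndromeʳ v ⊕ t z               ∎
        where
        open ≡-Reasoning
        w = words false false z (t z)

-- Regular affine groups

-- This is a left brace with additive group `F r`, and `L` is its lambda map. The law `L-⋆` states
-- that linear parts compose, and associativity of `_⋆_` follows from it.
record RegularGroup (r : ℕ) : Set where
  infixl 6 _⋆_
  field
    L     : F r → F r → F r
    inv   : F r → F r
    L-⊕   : ∀ a → Additive (L a)
    L-𝟎   : ∀ x → L 𝟎 x ≡ x
    L-⋆   : ∀ a b x → L (a ⊕ L a b) x ≡ L a (L b x)
    ⋆-inv : ∀ a → a ⊕ L a (inv a) ≡ 𝟎
    inv-⋆ : ∀ a → inv a ⊕ L (inv a) a ≡ 𝟎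

  _⋆_ : F r → F r → F r
  a ⋆ x = a ⊕ L a x

  ⋆-assoc : ∀ a b x → (a ⋆ b) ⋆ x ≡ a ⋆ (b ⋆ x)
  ⋆-assoc a b x = trans (⊕-assoc a (L a b) _)
    (cong (a ⊕_) (trans (cong (L a b ⊕_) (L-⋆ a b x)) (sym (L-⊕ a b (L b x)))))

  ⋆-identityˡ : ∀ x → 𝟎 ⋆ x ≡ x
  ⋆-identityˡ x = trans (⊕-identityˡ _) (L-𝟎 x)

  translation : F r → F r ↔ F r
  translation a = mk↔ₛ′ (a ⋆_) (inv a ⋆_)
    (λ x → trans (sym (⋆-assoc a (inv a) x)) (trans (cong (_⋆ x) (⋆-inv a)) (⋆-identityˡ x)))
    (λ x → trans (sym (⋆-assoc (inv a) a x)) (trans (cong (_⋆ x) (inv-⋆ a)) (⋆-identityˡ x)))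

  open Words r
  open Inverse (coordinates r) renaming (to to vectorAt; from to positionOf)

  perm : F r → Permutation′ (2 ^ r)
  perm a = ↔-sym (coordinates r) ↔-∘ (translation a ↔-∘ coordinates r)

  perm-𝟎 : perm 𝟎 Perm.≈ Perm.id
  perm-𝟎 i = trans (cong positionOf (⋆-identityˡ (vectorAt i))) (Inverse.strictlyInverseʳ (coordinates r) i)

  perm-⋆ : ∀ a b → perm b ∘ₚ perm a Perm.≈ perm (a ⋆ b)
  perm-⋆ a b i = cong positionOf (trans (cong (a ⋆_) (vectorAt∘positionOf (b ⋆ vectorAt i))) (sym (⋆-assoc a b (vectorAt i))))

  syndrome-perm : ∀ a {x} → parity x ≡ false → syndrome (permute (perm a) x) ≡ L a (syndrome x)
  syndrome-perm a {x} even = begin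
    syndrome (permute (perm a) x)
      ≡⟨ lincomb-permute (perm a) x vectorAt ⟩
    lincomb x (tabulate λ i → vectorAt (positionOf (a ⋆ vectorAt i)))
      ≡⟨ cong (lincomb x) (tabulate-cong λ i → vectorAt∘positionOf (a ⋆ vectorAt i)) ⟩
    lincomb x (tabulate λ i → a ⋆ vectorAt i)
      ≡⟨ lincomb-affine a {L a} (L-⊕ a) vectorAt x ⟩
    parity x • a ⊕ L a (syndrome x)
      ≡⟨ cong (λ b → b • a ⊕ L a (syndrome x)) even ⟩
    false • a ⊕ L a (syndrome x)
      ≡⟨ trans (cong (_⊕ L a (syndrome x)) (false• a)) (⊕-identityˡ _) ⟩
    L a (syndrome x) ∎
    where open ≡-Reasoning

-- Permutations acting on the two halves separately

infixr 5 _⊞ₚ_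
_⊞ₚ_ : Permutation′ m → Permutation′ n → Permutation′ (m + n)
π ⊞ₚ σ = ↔-sym +↔⊎ ↔-∘ ((π ⊎-↔ σ) ↔-∘ +↔⊎)

⊞ₚ-≈ : ∀ {π π′ : Permutation′ m} {σ σ′ : Permutation′ n} → π Perm.≈ π′ → σ Perm.≈ σ′ → (π ⊞ₚ σ) Perm.≈ (π′ ⊞ₚ σ′)
⊞ₚ-≈ {m} {n} p q i with splitAt m {n} i
... | inj₁ j = cong (join m n ∘ inj₁) (p j)
... | inj₂ j = cong (join m n ∘ inj₂) (q j)

⊞ₚ-id : (Perm.id {m} ⊞ₚ Perm.id {n}) Perm.≈ Perm.id
⊞ₚ-id {m} {n} i with splitAt m {n} i in eq
... | inj₁ j = trans (cong (join m n) (sym eq)) (join-splitAt m n i)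
... | inj₂ j = trans (cong (join m n) (sym eq)) (join-splitAt m n i)

⊞ₚ-∘ : (π π′ : Permutation′ m) (σ σ′ : Permutation′ n) →
       ((π ⊞ₚ σ) ∘ₚ (π′ ⊞ₚ σ′)) Perm.≈ ((π ∘ₚ π′) ⊞ₚ (σ ∘ₚ σ′))
⊞ₚ-∘ {m} {n} π π′ σ σ′ i with splitAt m {n} i
... | inj₁ j = cong (join m n ∘ Sum.map (π′ ⟨$⟩ʳ_) (σ′ ⟨$⟩ʳ_)) (splitAt-join m n (inj₁ (π ⟨$⟩ʳ j)))
... | inj₂ j = cong (join m n ∘ Sum.map (π′ ⟨$⟩ʳ_) (σ′ ⟨$⟩ʳ_)) (splitAt-join m n (inj₂ (σ ⟨$⟩ʳ j)))

permute-⊞ₚ : (π : Permutation′ m) (σ : Permutation′ n) (x : F m) (y : F n) →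
             permute (π ⊞ₚ σ) (x ++ y) ≡ permute π x ++ permute σ y
permute-⊞ₚ {m} {n} π σ x y = trans (tabulate-cong pointwise) (tabulate∘lookup _)
  where
  open ≡-Reasoning
  pointwise : ∀ i → lookup (x ++ y) ((π ⊞ₚ σ) ⟨$⟩ˡ i) ≡ lookup (permute π x ++ permute σ y) i
  pointwise i = begin
    lookup (x ++ y) (join m n (Sum.map (π ⟨$⟩ˡ_) (σ ⟨$⟩ˡ_) (splitAt m i)))
      ≡⟨ lookup-splitAt m x y _ ⟩
    [ lookup x , lookup y ]′ (splitAt m (join m n (Sum.map (π ⟨$⟩ˡ_) (σ ⟨$⟩ˡ_) (splitAt m i))))
      ≡⟨ cong [ lookup x , lookup y ]′ (splitAt-join m n (Sum.map (π ⟨$⟩ˡ_) (σ ⟨$⟩ˡ_) (splitAt m i))) ⟩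
    [ lookup x , lookup y ]′ (Sum.map (π ⟨$⟩ˡ_) (σ ⟨$⟩ˡ_) (splitAt m i))
      ≡⟨ side (splitAt m i) ⟩
    [ lookup (permute π x) , lookup (permute σ y) ]′ (splitAt m i)
      ≡⟨ lookup-splitAt m (permute π x) (permute σ y) i ⟨
    lookup (permute π x ++ permute σ y) i ∎
    where
    side : (j : Fin m ⊎ Fin n) → [ lookup x , lookup y ]′ (Sum.map (π ⟨$⟩ˡ_) (σ ⟨$⟩ˡ_) j) ≡
                                 [ lookup (permute π x) , lookup (permute σ y) ]′ j
    side (inj₁ j) = sym (lookup∘tabulate _ j)
    side (inj₂ j) = sym (lookup∘tabulate _ j)

-- Propelinearity

-- `IsPropelinear` asks only that group and code share some cardinality, so N comes out of a
-- recursion on the first coordinate instead of a formula for the size of the code.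
decidable⇒cardinality : {C : Code n} → Decidable C → ∃[ N ] HasCardinality (subset (setoid (F n)) C) N
decidable⇒cardinality {zero} {C} C? with C? []
... | yes []∈C = 1 , record
  { to = λ _ → zero ; from = λ _ → [] , []∈C ; to-cong = λ _ → refl ; from-cong = λ _ → refl
  ; inverse = (λ { {zero} _ → refl }) , (λ { {[] , _} _ → refl }) }
... | no []∉C = 0 , record
  { to = λ { ([] , []∈C) → contradiction []∈C []∉C } ; from = λ ()
  ; to-cong = λ { {[] , []∈C} → contradiction []∈C []∉C } ; from-cong = λ { {()} }
  ; inverse = (λ { {()} }) , (λ { {[] , []∈C} → contradiction []∈C []∉C }) }
decidable⇒cardinality {suc n} {C} C?
  with decidable⇒cardinality (C? ∘ (false ∷_)) | decidable⇒cardinality (C? ∘ (true ∷_))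
... | M , I | N , J = M + N , record
  { to = to ; from = from ∘ splitAt M
  ; to-cong = to-cong ; from-cong = λ { refl → refl }
  ; inverse = (λ {i} {x} eq → trans (to-cong {x} {from (splitAt M i)} eq) (trans (to-from (splitAt M i)) (join-splitAt M N i)))
            , (λ { {x} refl → from-to x }) }
  where
  module I = Inverse I
  module J = Inverse J
  to : ∃ C → Fin (M + N)
  to (false ∷ x , x∈C) = join M N (inj₁ (I.to (x , x∈C)))
  to (true ∷ x , x∈C)  = join M N (inj₂ (J.to (x , x∈C)))
  from : Fin M ⊎ Fin N → ∃ C
  from (inj₁ i) = let x , x∈C = I.from i in false ∷ x , x∈C
  from (inj₂ i) = let x , x∈C = J.from i in true ∷ x , x∈C
  -- Membership proofs may differ for the same word, so independence from them is carried through
  -- the recursion.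
  to-cong : ∀ {x y : ∃ C} → proj₁ x ≡ proj₁ y → to x ≡ to y
  to-cong {false ∷ x , _} {_ , _} refl = cong (join M N ∘ inj₁) (I.to-cong refl)
  to-cong {true ∷ x , _}  {_ , _} refl = cong (join M N ∘ inj₂) (J.to-cong refl)
  to-from : ∀ i → to (from i) ≡ join M N i
  to-from (inj₁ i) = cong (join M N ∘ inj₁) (I.strictlyInverseˡ i)
  to-from (inj₂ i) = cong (join M N ∘ inj₂) (J.strictlyInverseˡ i)
  from-to : ∀ x → proj₁ (from (splitAt M (to x))) ≡ proj₁ x
  from-to (false ∷ x , x∈C) = trans (cong (proj₁ ∘ from) (splitAt-join M N (inj₁ (I.to (x , x∈C))))) (cong (false ∷_) (I.strictlyInverseʳ _))
  from-to (true ∷ x , x∈C)  = trans (cong (proj₁ ∘ from) (splitAt-join M N (inj₂ (J.to (x , x∈C))))) (cong (true ∷_) (J.strictlyInverseʳ _))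

-- Involutivity reduces bijectivity to one equation that can be checked by evaluation.
record Automorphism (G : RegularGroup r) : Set where
  open RegularGroup G
  field
    τ            : F r → F r
    τ-𝟎          : τ 𝟎 ≡ 𝟎
    τ-⋆          : ∀ a b → τ (a ⋆ b) ≡ τ a ⋆ τ b
    τ-involutive : ∀ a → τ (τ a) ≡ a

  bijection : F r ⤖ F r
  bijection = ↔⇒⤖ (mk↔ₛ′ τ τ τ-involutive τ-involutive)

  open Words r

  θ : F r → Permutation′ (2 ^ r + 2 ^ r)
  θ a = perm a ⊞ₚ perm (τ a)

  θ-𝟎 : θ 𝟎 Perm.≈ Perm.id
  θ-𝟎 i = trans (⊞ₚ-≈ {π = perm 𝟎} {Perm.id} {perm (τ 𝟎)} {Perm.id} perm-𝟎 (subst (λ a → perm a Perm.≈ Perm.id) (sym τ-𝟎) perm-𝟎) i)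
                (⊞ₚ-id {2 ^ r} i)

  θ-⋆ : ∀ a b → θ b ∘ₚ θ a Perm.≈ θ (a ⋆ b)
  θ-⋆ a b i = trans (⊞ₚ-∘ (perm b) (perm a) (perm (τ b)) (perm (τ a)) i)
    (⊞ₚ-≈ {π = perm b ∘ₚ perm a} {perm (a ⋆ b)} {perm (τ b) ∘ₚ perm (τ a)} {perm (τ (a ⋆ b))}
      (perm-⋆ a b) (λ i → trans (perm-⋆ (τ a) (τ b) i) (cong (λ c → perm c ⟨$⟩ʳ i) (sym (τ-⋆ a b)))) i)

  permute-θ : ∀ a w → permute (θ a) w ≡ permute (perm a) (left w) ++ permute (perm (τ a)) (right w)
  permute-θ a w = trans (cong (permute (θ a)) (sym (take++drop≡id (2 ^ r) w))) (permute-⊞ₚ (perm a) (perm (τ a)) (left w) (right w))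

  private
    C : Code (2 ^ r + 2 ^ r)
    C = S bijection

    open Group (AutF (2 ^ r + 2 ^ r)) using () renaming
      ( _≈_ to _≈ₜ_; refl to ≈ₜ-refl; sym to ≈ₜ-sym; trans to ≈ₜ-trans
      ; ε to idₜ; _⁻¹ to _⁻¹ₜ; ∙-cong to ∙ₜ-cong; ⁻¹-cong to ⁻¹ₜ-cong; identityˡ to identityˡₜ; identityʳ to identityʳₜ; inverseʳ to inverseʳₜ; inverseˡ to inverseˡₜ; setoid to setoidₜ)
    open GroupProperties (AutF (2 ^ r + 2 ^ r)) using (inverseˡ-unique)

  standard : F (2 ^ r + 2 ^ r) → Transformation (2 ^ r + 2 ^ r)
  standard w = w , θ (syndromeˡ w)

  syndromes-permute : ∀ a {w} → C w → let w′ = permute (θ a) w in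
                      parityˡ w′ ≡ false × parityʳ w′ ≡ false ×
                      syndromeˡ w′ ≡ L a (syndromeˡ w) × syndromeʳ w′ ≡ L (τ a) (syndromeʳ w)
  syndromes-permute a {w} w∈C with S⇒evenWord bijection w∈C
  ... | evenWord p q _ =
      trans (cong parity l) (trans (parity-permute (perm a) (left w)) p)
    , trans (cong parity r′) (trans (parity-permute (perm (τ a)) (right w)) q)
    , trans (cong syndrome l) (syndrome-perm a {left w} p)
    , trans (cong syndrome r′) (syndrome-perm (τ a) {right w} q)
    where
    l = trans (cong left (permute-θ a w)) (take-++ (permute (perm a) (left w)) _)
    r′ = trans (cong right (permute-θ a w)) (drop-++ (permute (perm a) (left w)) _)

  syndromeˡ-act : ∀ v {w} → C w → syndromeˡ (act (standard v) w) ≡ syndromeˡ v ⋆ syndromeˡ w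
  syndromeˡ-act v {w} w∈C = trans (syndromeˡ-⊕ v (permute (θ (syndromeˡ v)) w))
    (cong (syndromeˡ v ⊕_) (proj₁ (proj₂ (proj₂ (syndromes-permute (syndromeˡ v) w∈C)))))

  act∈C : ∀ {v w} → C v → C w → C (act (standard v) w)
  act∈C {v} {w} v∈C w∈C with S⇒evenWord bijection v∈C | S⇒evenWord bijection w∈C | syndromes-permute (syndromeˡ v) w∈C
  ... | evenWord p q s | evenWord _ _ s′ | p′ , q′ , _ , t′ = evenWord⇒S bijection (evenWord
    (trans (parityˡ-⊕ v _) (cong₂ _xor_ p p′))
    (trans (parityʳ-⊕ v _) (cong₂ _xor_ q q′))
    (begin
      syndromeʳ (act (standard v) w)                ≡⟨ trans (syndromeʳ-⊕ v _) (cong (syndromeʳ v ⊕_) t′) ⟩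
      syndromeʳ v ⊕ L (τ a) (syndromeʳ w)           ≡⟨ cong₂ (λ x y → x ⊕ L (τ a) y) s s′ ⟩
      τ a ⋆ τ (syndromeˡ w)                         ≡⟨ τ-⋆ a (syndromeˡ w) ⟨
      τ (a ⋆ syndromeˡ w)                           ≡⟨ cong τ (syndromeˡ-act v w∈C) ⟨
      τ (syndromeˡ (act (standard v) w))            ∎))
    where
    open ≡-Reasoning
    a = syndromeˡ v

  standard-∙ : ∀ v {w} → C w → (standard v ∙ standard w) ≈ₜ standard (act (standard v) w)
  standard-∙ v {w} w∈C = refl , λ i →
    trans (θ-⋆ (syndromeˡ v) (syndromeˡ w) i) (cong (λ a → θ a ⟨$⟩ʳ i) (sym (syndromeˡ-act v w∈C)))

  standard-𝟎 : standard 𝟎 ≈ₜ idₜ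
  standard-𝟎 = refl , λ i → trans (cong (λ a → θ a ⟨$⟩ʳ i) (additive-𝟎 {f = syndromeˡ} syndromeˡ-⊕)) (θ-𝟎 i)

  act-cong : ∀ {g h} → g ≈ₜ h → ∀ w → act g w ≡ act h w
  act-cong {g} {h} g≈h w = proj₁ (∙ₜ-cong {g} {h} {w , Perm.id} {w , Perm.id} g≈h (≈ₜ-refl {w , Perm.id}))

  act-𝟎 : ∀ g → act g 𝟎 ≡ proj₁ g
  act-𝟎 g = proj₁ (identityʳₜ g)

  act-id : ∀ w → act idₜ w ≡ w
  act-id w = proj₁ (identityˡₜ (w , Perm.id))

  -- The inverse must send `v` to 𝟎, so its translation part is the permuted `v`. From b ⋆ a = 𝟎
  -- follows L b a = b, so this word has left syndrome b and its own permutation is `θ b`; the same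
  -- argument under τ puts it in the code.
  inverse-word : ∀ {v} → C v → ∃[ w ] (C w × (standard w ∙ standard v) ≈ₜ idₜ)
  inverse-word {v} v∈C with S⇒evenWord bijection v∈C | syndromes-permute (inv (syndromeˡ v)) v∈C
  ... | evenWord _ _ s | p , q , sˡ , sʳ =
      w
    , evenWord⇒S bijection (evenWord p q (begin
        syndromeʳ w                    ≡⟨ trans sʳ (cong (L (τ b)) s) ⟩
        L (τ b) (τ a)                  ≡⟨ ⊕≡𝟎⇒≡ (τ b) _ (trans (sym (τ-⋆ b a)) (trans (cong τ (inv-⋆ a)) τ-𝟎)) ⟨
        τ b                            ≡⟨ cong τ w-syndrome ⟨
        τ (syndromeˡ w)                ∎))
    , ≈ₜ-trans {standard w ∙ standard v} {standard (act (standard w) v)} {idₜ} (standard-∙ w v∈C)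
        (subst (λ u → standard u ≈ₜ idₜ) (sym (trans (cong (λ c → w ⊕ permute (θ c) v) w-syndrome) (⊕-self w))) standard-𝟎)
    where
    open ≡-Reasoning
    a = syndromeˡ v
    b = inv a
    w = permute (θ b) v
    w-syndrome : syndromeˡ w ≡ b
    w-syndrome = trans sˡ (sym (⊕≡𝟎⇒≡ b _ (inv-⋆ a)))

  -- Membership is stated up to `_≈ₜ_` because permutations are compared pointwise and a subgroup
  -- must respect that equality.
  𝒢 : Pred (Transformation (2 ^ r + 2 ^ r)) 0ℓ
  𝒢 g = C (proj₁ g) × standard (proj₁ g) ≈ₜ g

  standard∈G : ∀ {w} → C w → 𝒢 (standard w)
  standard∈G {w} w∈C = w∈C , ≈ₜ-refl {standard w}

  𝒢-resp-≈ : ∀ {g h} → g ≈ₜ h → 𝒢 g → 𝒢 h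
  𝒢-resp-≈ {g} {h} (refl , p) (g∈C , q) = g∈C , ≈ₜ-trans {standard (proj₁ g)} {g} {h} q (refl , p)

  ∙-closed : ∀ {g h} → 𝒢 g → 𝒢 h → 𝒢 (g ∙ h)
  ∙-closed {g} {h} (v∈C , p) (w∈C , q) =
    𝒢-resp-≈ {standard (act (standard v) w)} {g ∙ h}
      (≈ₜ-trans {standard (act (standard v) w)} {standard v ∙ standard w} {g ∙ h}
        (≈ₜ-sym {standard v ∙ standard w} {standard (act (standard v) w)} (standard-∙ v w∈C)) (∙ₜ-cong {standard v} {g} {standard w} {h} p q))
      (standard∈G (act∈C v∈C w∈C))
    where
    v = proj₁ g
    w = proj₁ h

  ⁻¹-closed : ∀ {g} → 𝒢 g → 𝒢 (g ⁻¹ₜ)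
  ⁻¹-closed {g} (v∈C , p) with inverse-word v∈C
  ... | w , w∈C , eq = 𝒢-resp-≈ {standard w} {g ⁻¹ₜ}
    (≈ₜ-trans {standard w} {standard (proj₁ g) ⁻¹ₜ} {g ⁻¹ₜ} (inverseˡ-unique (standard w) (standard (proj₁ g)) eq)
      (⁻¹ₜ-cong {standard (proj₁ g)} {g} p))
    (standard∈G w∈C)

  act-closed : ∀ {g w} → 𝒢 g → C w → C (act g w)
  act-closed {g} {w} (v∈C , p) w∈C = subst C (act-cong {standard (proj₁ g)} {g} p w) (act∈C v∈C w∈C)

  act-inverseʳ : ∀ g w → act g (act (g ⁻¹ₜ) w) ≡ w
  act-inverseʳ g w = trans (sym (act-∙ g (g ⁻¹ₜ) w)) (trans (act-cong {g ∙ (g ⁻¹ₜ)} {idₜ} (inverseʳₜ g) w) (act-id w))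

  act-inverse-𝟎 : ∀ g → act (g ⁻¹ₜ) (proj₁ g) ≡ 𝟎
  act-inverse-𝟎 g = trans (cong (act (g ⁻¹ₜ)) (sym (act-𝟎 g)))
    (trans (sym (act-∙ (g ⁻¹ₜ) g 𝟎)) (trans (act-cong {(g ⁻¹ₜ) ∙ g} {idₜ} (inverseˡₜ g) 𝟎) (act-id 𝟎)))

  𝒢-subgroup : IsSubgroup (AutF (2 ^ r + 2 ^ r)) 𝒢
  𝒢-subgroup = record
    { respects  = λ {g} {h} → 𝒢-resp-≈ {g} {h}
    ; ε-closed  = 𝒢-resp-≈ {standard 𝟎} {idₜ} standard-𝟎 (standard∈G (𝟎∈S bijection τ-𝟎))
    ; ∙-closed  = λ {g} {h} → ∙-closed {g} {h}
    ; ⁻¹-closed = λ {g} → ⁻¹-closed {g}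
    }

  𝒢-cardinality : ∀ {N} → HasCardinality (subset (setoid _) C) N → HasCardinality (subset setoidₜ 𝒢) N
  𝒢-cardinality I = record
    { to        = λ (g , v∈C , _) → to (proj₁ g , v∈C)
    ; from      = λ i → let w , w∈C = from i in standard w , standard∈G w∈C
    ; to-cong   = λ (eq , _) → to-cong eq
    ; from-cong = λ { {i} refl → ≈ₜ-refl {standard (proj₁ (from i))} }
    ; inverse   = (λ (eq , _) → inverseˡ eq)
                , λ { {g , v∈C , p} {i} eq → subst (λ w → standard w ≈ₜ g) (sym (inverseʳ {proj₁ g , v∈C} eq)) p }
    }
    where open Inverse I

  S? : Decidable C
  S? w = map′ (evenWord⇒S bijection) (S⇒evenWord bijection)
    (map′ (λ (p , q , s) → evenWord p q s) (λ (evenWord p q s) → p , q , s)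
      (parityˡ w Bool.≟ false ×-dec parityʳ w Bool.≟ false ×-dec ≡-dec Bool._≟_ (syndromeʳ w) (τ (syndromeˡ w))))

  propelinear : IsPropelinear C
  propelinear = 𝒢 , 𝒢-subgroup
    , (λ {g} g∈G → (λ { (x , x∈C , refl) → act-closed {g} g∈G x∈C })
                 , (λ {y} y∈C → act (g ⁻¹ₜ) y , act-closed {g ⁻¹ₜ} (⁻¹-closed {g} g∈G) y∈C , act-inverseʳ g y))
    , (let N , I = decidable⇒cardinality S? in N , 𝒢-cardinality I , I)
    -- Transitivity passes through 𝟎, which `standard x` carries to `x` and `standard y` to `y`.
    , (λ {x} {y} x∈C y∈C →
          standard y ∙ (standard x ⁻¹ₜ)
        , ∙-closed {standard y} {standard x ⁻¹ₜ} (standard∈G y∈C) (⁻¹-closed {standard x} (standard∈G x∈C))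
        , trans (act-∙ (standard y) (standard x ⁻¹ₜ) x) (trans (cong (act (standard y)) (act-inverse-𝟎 (standard x))) (act-𝟎 (standard y))))

-- Extended perfect codes

unit : Fin n → F n
unit i = 𝟎 [ i ]≔ true

hamming-self : (x : F n) → hamming x x ≡ 0
hamming-self []          = refl
hamming-self (false ∷ x) = hamming-self x
hamming-self (true ∷ x)  = hamming-self x

hamming≡0⇒≡ : (x y : F n) → hamming x y ≤ 0 → y ≡ x
hamming≡0⇒≡ []          []          h = refl
hamming≡0⇒≡ (false ∷ x) (false ∷ y) h = cong (false ∷_) (hamming≡0⇒≡ x y h)
hamming≡0⇒≡ (true ∷ x)  (true ∷ y)  h = cong (true ∷_) (hamming≡0⇒≡ x y h)

-- Enumerates the ball of radius one. Index zero, the centre, matches the parity coordinate of the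
-- extended word.
near : F n → Fin (suc n) → F n
near x zero    = x
near x (suc i) = x ⊕ unit i

hamming-near : (x : F n) (i : Fin (suc n)) → hamming x (near x i) ≤ 1
hamming-near x zero = ℕ.≤-trans (ℕ.≤-reflexive (hamming-self x)) z≤n
hamming-near (false ∷ x) (suc zero) rewrite ⊕-identityʳ x = s≤s (ℕ.≤-reflexive (hamming-self x))
hamming-near (true ∷ x)  (suc zero) rewrite ⊕-identityʳ x = s≤s (ℕ.≤-reflexive (hamming-self x))
hamming-near (false ∷ x) (suc (suc i)) = hamming-near x (suc i)
hamming-near (true ∷ x)  (suc (suc i)) = hamming-near x (suc i)

hamming≤1⇒near : (x y : F n) → hamming x y ≤ 1 → ∃[ i ] near x i ≡ y
hamming≤1⇒near []          []          h = zero , refl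
hamming≤1⇒near (false ∷ x) (true ∷ y)  (s≤s h) = suc zero , cong (true ∷_) (trans (⊕-identityʳ x) (sym (hamming≡0⇒≡ x y h)))
hamming≤1⇒near (true ∷ x)  (false ∷ y) (s≤s h) = suc zero , cong (false ∷_) (trans (⊕-identityʳ x) (sym (hamming≡0⇒≡ x y h)))
hamming≤1⇒near (false ∷ x) (false ∷ y) h with hamming≤1⇒near x y h
... | zero  , eq = zero , cong (false ∷_) eq
... | suc i , eq = suc (suc i) , cong (false ∷_) eq
hamming≤1⇒near (true ∷ x) (true ∷ y) h with hamming≤1⇒near x y h
... | zero  , eq = zero , cong (true ∷_) eq
... | suc i , eq = suc (suc i) , cong (true ∷_) eq

-- Extension turns the ball around `x` into the single flips of one odd word, namely `x` with the
-- wrong parity bit.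
extendAt-near : (x : F n) (i : Fin (suc n)) → extendAt zero (near x i) ≡ (not (parity x) ∷ x) ⊕ unit i
extendAt-near x zero = cong₂ _∷_ (lemma (parity x)) (sym (⊕-identityʳ x))
  where
  lemma : ∀ b → b ≡ not b xor true
  lemma true  = refl
  lemma false = refl
extendAt-near x (suc i) = cong (_∷ (x ⊕ unit i)) (trans (parity-⊕ x (unit i)) (trans (cong (parity x xor_) (parity-unit i)) (lemma (parity x))))
  where
  lemma : ∀ b → b xor true ≡ not b xor false
  lemma true  = refl
  lemma false = refl

-- Puncturing the first coordinate turns "unique coordinate whose flip lands in D" into "unique
-- codeword at distance at most 1".
even-covering⇒extendedPerfect : (D : Code n) → 1 ≤ n → (∀ {w} → D w → parity w ≡ false) →
  (∀ x → parity x ≡ true → ∃! _≡_ λ i → D (x ⊕ unit i)) → IsExtendedPerfect D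
even-covering⇒extendedPerfect {suc m} D _ even covering = extended C perfect zero D (D⊆ , ⊆D)
  where
  C : Code m
  C y = D (extendAt zero y)
  xor≡false⇒≡ : ∀ b c → b xor c ≡ false → c ≡ b
  xor≡false⇒≡ true  true  _ = refl
  xor≡false⇒≡ false false _ = refl
  not-xor : ∀ b → not b xor b ≡ true
  not-xor true  = refl
  not-xor false = refl
  D⊆ : D ⊆ image (extendAt zero) C
  D⊆ {b ∷ y} w∈D with xor≡false⇒≡ b (parity y) (even w∈D)
  ... | refl = y , w∈D , refl
  ⊆D : image (extendAt zero) C ⊆ D
  ⊆D (_ , w∈D , refl) = w∈D
  perfect : IsPerfect C
  perfect x with covering (not (parity x) ∷ x) (not-xor (parity x))
  ... | i , w∈D , unique = near x i , (subst D (sym (extendAt-near x i)) w∈D , hamming-near x i) , near-unique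
    where
    near-unique : ∀ {y} → C y × hamming x y ≤ 1 → near x i ≡ y
    near-unique {y} (y∈C , h) with hamming≤1⇒near x y h
    ... | j , refl = cong (near x) (unique (subst D (extendAt-near x j) y∈C))

-- Unique flips of odd words into the code

unit-↑ˡ : ∀ (i : Fin m) n → unit (i ↑ˡ n) ≡ unit i ++ 𝟎
unit-↑ˡ {suc m} zero    n = cong (true ∷_) (sym (𝟎++𝟎 m))
unit-↑ˡ (suc i) n = cong (false ∷_) (unit-↑ˡ i n)

unit-↑ʳ : ∀ m (i : Fin n) → unit (m ↑ʳ i) ≡ 𝟎 ++ unit i
unit-↑ʳ zero    i = refl
unit-↑ʳ (suc m) i = cong (false ∷_) (unit-↑ʳ m i)

parity-++ : (x : F m) (y : F n) → parity (x ++ y) ≡ parity x xor parity y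
parity-++ []      y = refl
parity-++ (b ∷ x) y = trans (cong (b xor_) (parity-++ x y)) (sym (Bool.xor-assoc b (parity x) (parity y)))

module _ {r : ℕ} (τ : F r ⤖ F r) where
  open Words r
  open Inverse (coordinates r) renaming (to to vectorAt; from to positionOf)
  open Bijection τ using (injective; strictlySurjective) renaming (to to t)

  private
    N = 2 ^ r

    flip : F (N + N) → Fin N ⊎ Fin N → F (N + N)
    flip x j = x ⊕ unit (join N N j)

    -- An odd word has exactly one odd half, and the flip must fall there. The syndrome equation
    -- then determines the flipped coordinate: on the left by bijectivity of τ, on the right by
    -- cancellation.
    data Cover (x : F (N + N)) : Fin N ⊎ Fin N → Set where
      coverˡ : ∀ {i} → parityˡ x ≡ true → parityʳ x ≡ false → syndromeʳ x ≡ t (syndromeˡ x ⊕ vectorAt i) → Cover x (inj₁ i)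
      coverʳ : ∀ {i} → parityˡ x ≡ false → parityʳ x ≡ true → syndromeʳ x ⊕ vectorAt i ≡ t (syndromeˡ x) → Cover x (inj₂ i)

    parityˡ-flip : ∀ x j → parityˡ (flip x j) ≡ parityˡ x xor [ const true , const false ]′ j
    parityˡ-flip x j = trans (parityˡ-⊕ x _) (cong (parityˡ x xor_) (lemma j))
      where
      lemma : ∀ j → parityˡ (unit (join N N j)) ≡ [ const true , const false ]′ j
      lemma (inj₁ i) = trans (cong parityˡ (unit-↑ˡ i N)) (trans (cong parity (take-++ (unit i) (𝟎 {N}))) (parity-unit i))
      lemma (inj₂ i) = trans (cong parityˡ (unit-↑ʳ N i)) (trans (cong parity (take-++ (𝟎 {N}) (unit i))) (parity-𝟎 N))

    parityʳ-flip : ∀ x j → parityʳ (flip x j) ≡ parityʳ x xor [ const false , const true ]′ j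
    parityʳ-flip x j = trans (parityʳ-⊕ x _) (cong (parityʳ x xor_) (lemma j))
      where
      lemma : ∀ j → parityʳ (unit (join N N j)) ≡ [ const false , const true ]′ j
      lemma (inj₁ i) = trans (cong parityʳ (unit-↑ˡ i N)) (trans (cong parity (drop-++ (unit i) (𝟎 {N}))) (parity-𝟎 N))
      lemma (inj₂ i) = trans (cong parityʳ (unit-↑ʳ N i)) (trans (cong parity (drop-++ (𝟎 {N}) (unit i))) (parity-unit i))

    syndromeˡ-flip : ∀ x j → syndromeˡ (flip x j) ≡ syndromeˡ x ⊕ [ vectorAt , const 𝟎 ]′ j
    syndromeˡ-flip x j = trans (syndromeˡ-⊕ x _) (cong (syndromeˡ x ⊕_) (lemma j))
      where
      lemma : ∀ j → syndromeˡ (unit (join N N j)) ≡ [ vectorAt , const 𝟎 ]′ j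
      lemma (inj₁ i) = trans (cong syndromeˡ (unit-↑ˡ i N)) (trans (cong syndrome (take-++ (unit i) (𝟎 {N}))) (lincomb-unit vectorAt i))
      lemma (inj₂ i) = trans (cong syndromeˡ (unit-↑ʳ N i)) (trans (cong syndrome (take-++ (𝟎 {N}) (unit i))) (lincomb-𝟎 (tabulate vectorAt)))

    syndromeʳ-flip : ∀ x j → syndromeʳ (flip x j) ≡ syndromeʳ x ⊕ [ const 𝟎 , vectorAt ]′ j
    syndromeʳ-flip x j = trans (syndromeʳ-⊕ x _) (cong (syndromeʳ x ⊕_) (lemma j))
      where
      lemma : ∀ j → syndromeʳ (unit (join N N j)) ≡ [ const 𝟎 , vectorAt ]′ j
      lemma (inj₁ i) = trans (cong syndromeʳ (unit-↑ˡ i N)) (trans (cong syndrome (drop-++ (unit i) (𝟎 {N}))) (lincomb-𝟎 (tabulate vectorAt)))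
      lemma (inj₂ i) = trans (cong syndromeʳ (unit-↑ʳ N i)) (trans (cong syndrome (drop-++ (𝟎 {N}) (unit i))) (lincomb-unit vectorAt i))

    xor-true⁻ : ∀ b → b xor true ≡ false → b ≡ true
    xor-true⁻ true _ = refl

    xor-false⁻ : ∀ b → b xor false ≡ false → b ≡ false
    xor-false⁻ false _ = refl

    S⇒cover : ∀ x j → S τ (flip x j) → Cover x j
    S⇒cover x j w∈S with S⇒evenWord τ w∈S
    ... | evenWord p q s with trans (sym (parityˡ-flip x j)) p | trans (sym (parityʳ-flip x j)) q
                            | trans (sym (syndromeʳ-flip x j)) (trans s (cong t (syndromeˡ-flip x j)))
    S⇒cover x (inj₁ i) w∈S | _ | p | q | s = coverˡ (xor-true⁻ _ p) (xor-false⁻ _ q) (trans (sym (⊕-identityʳ _)) s)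
    S⇒cover x (inj₂ i) w∈S | _ | p | q | s = coverʳ (xor-false⁻ _ p) (xor-true⁻ _ q) (trans s (cong t (⊕-identityʳ _)))

    cover⇒S : ∀ x j → Cover x j → S τ (flip x j)
    cover⇒S x j (coverˡ p q s) = evenWord⇒S τ (evenWord
      (trans (parityˡ-flip x j) (cong (_xor true) p))
      (trans (parityʳ-flip x j) (cong (_xor false) q))
      (trans (syndromeʳ-flip x j) (trans (⊕-identityʳ _) (trans s (cong t (sym (syndromeˡ-flip x j)))))))
    cover⇒S x j (coverʳ p q s) = evenWord⇒S τ (evenWord
      (trans (parityˡ-flip x j) (cong (_xor false) p))
      (trans (parityʳ-flip x j) (cong (_xor true) q))
      (trans (syndromeʳ-flip x j) (trans s (cong t (sym (trans (syndromeˡ-flip x j) (⊕-identityʳ _)))))))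

    vectorAt-injective : ∀ {i j} → vectorAt i ≡ vectorAt j → i ≡ j
    vectorAt-injective {i} {j} eq = trans (sym (Inverse.strictlyInverseʳ (coordinates r) i))
      (trans (cong positionOf eq) (Inverse.strictlyInverseʳ (coordinates r) j))

    cover-unique : ∀ {x j j′} → Cover x j → Cover x j′ → j ≡ j′
    cover-unique {x} (coverˡ _ _ s) (coverˡ _ _ s′) =
      cong inj₁ (vectorAt-injective (⊕-cancelˡ (syndromeˡ x) _ _ (injective (trans (sym s) s′))))
    cover-unique (coverˡ p _ _) (coverʳ p′ _ _) = contradiction (trans (sym p) p′) λ ()
    cover-unique (coverʳ p _ _) (coverˡ p′ _ _) = contradiction (trans (sym p) p′) λ ()
    cover-unique {x} (coverʳ _ _ s) (coverʳ _ _ s′) =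
      cong inj₂ (vectorAt-injective (⊕-cancelˡ (syndromeʳ x) _ _ (trans s (sym s′))))

    cover-exists : ∀ x → parityˡ x xor parityʳ x ≡ true → ∃ (Cover x)
    cover-exists x odd with parityˡ x in p | parityʳ x in q
    cover-exists x () | true | true
    ... | true | false = let a , ta≡ = strictlySurjective (syndromeʳ x) in
      inj₁ (positionOf (syndromeˡ x ⊕ a)) , coverˡ p q (sym (trans
        (cong (λ v → t (syndromeˡ x ⊕ v)) (vectorAt∘positionOf _)) (trans (cong t (x⊕[x⊕y]≡y (syndromeˡ x) a)) ta≡)))
    ... | false | true =
      inj₂ (positionOf (syndromeʳ x ⊕ t (syndromeˡ x))) , coverʳ p q (trans
        (cong (syndromeʳ x ⊕_) (vectorAt∘positionOf _)) (x⊕[x⊕y]≡y (syndromeʳ x) _))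

    parity-halves : ∀ x → parity x ≡ parityˡ x xor parityʳ x
    parity-halves x = trans (cong parity (sym (take++drop≡id N x))) (parity-++ (left x) (right x))

  S-extendedPerfect : IsExtendedPerfect (S τ)
  S-extendedPerfect = even-covering⇒extendedPerfect (S τ) (ℕ.≤-trans (ℕ.m^n>0 2 r) (ℕ.m≤m+n N N)) even covering
    where
    even : ∀ {w} → S τ w → parity w ≡ false
    even {w} w∈S with S⇒evenWord τ w∈S
    ... | evenWord p q _ = trans (parity-halves w) (cong₂ _xor_ p q)
    covering : ∀ x → parity x ≡ true → ∃! _≡_ λ i → S τ (x ⊕ unit i)
    covering x odd with cover-exists x (trans (sym (parity-halves x)) odd)
    ... | j , c = join N N j , cover⇒S x j c , λ {i} w∈S → trans
      (cong (join N N) (cover-unique c (S⇒cover x (splitAt N i) (subst (S τ ∘ (x ⊕_) ∘ unit) (sym (join-splitAt N N i)) w∈S))))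
      (join-splitAt N N i)

-- Exhaustive search

∀? : ∀ n {P : F n → Set} → Decidable P → Dec (∀ x → P x)
∀? zero    P? = map′ (λ { p [] → p }) (λ p → p []) (P? [])
∀? (suc n) P? = map′ (λ { (p , q) (false ∷ x) → p x ; (p , q) (true ∷ x) → q x })
  (λ p → p ∘ (false ∷_) , p ∘ (true ∷_)) (∀? n (P? ∘ (false ∷_)) ×-dec ∀? n (P? ∘ (true ∷_)))

∃? : ∀ n {P : F n → Set} → Decidable P → Dec (∃ P)
∃? zero    P? = map′ (λ p → [] , p) (λ { ([] , p) → p }) (P? [])
∃? (suc n) P? = map′ [ (λ (x , p) → false ∷ x , p) , (λ (x , p) → true ∷ x , p) ]′
  (λ { (false ∷ x , p) → inj₁ (x , p) ; (true ∷ x , p) → inj₂ (x , p) }) (∃? n (P? ∘ (false ∷_)) ⊎-dec ∃? n (P? ∘ (true ∷_)))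

infix 4 _≟_
_≟_ : (x y : F n) → Dec (x ≡ y)
_≟_ = ≡-dec Bool._≟_

-- The relation L (a ⋆ b) = L a ∘ L b is tested on the standard basis only, so that the search is
-- over pairs and not over triples.
module _ (L : F r → F r → F r) where
  private
    _⋆_ : F r → F r → F r
    a ⋆ x = a ⊕ L a x

    -- Only groups of exponent dividing 8 are needed.
    inv : F r → F r
    inv a = fold 𝟎 (a ⋆_) 7

  IsRegular : Set
  IsRegular = (∀ a x → lincomb x (basis (L a)) ≡ L a x)
            × (∀ x → L 𝟎 x ≡ x)
            × (∀ a b → basis (L (a ⋆ b)) ≡ map (L a) (basis (L b)))
            × (∀ a → a ⋆ inv a ≡ 𝟎)
            × (∀ a → inv a ⋆ a ≡ 𝟎)

  isRegular? : Dec IsRegular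
  isRegular? = ∀? r (λ a → ∀? r λ x → lincomb x (basis (L a)) ≟ L a x)
         ×-dec ∀? r (λ x → L 𝟎 x ≟ x)
         ×-dec ∀? r (λ a → ∀? r λ b → ≡-dec _≟_ (basis (L (a ⋆ b))) (map (L a) (basis (L b))))
         ×-dec ∀? r (λ a → a ⋆ inv a ≟ 𝟎)
         ×-dec ∀? r (λ a → inv a ⋆ a ≟ 𝟎)

  regularGroup : IsRegular → RegularGroup r
  regularGroup (linear , L-𝟎 , L-⋆ , ⋆-inv , inv-⋆) = record
    { L     = L
    ; inv   = inv
    ; L-⊕   = L-⊕
    ; L-𝟎   = L-𝟎
    ; L-⋆   = λ a b x → begin
        L (a ⋆ b) x                              ≡⟨ linear (a ⋆ b) x ⟨
        lincomb x (basis (L (a ⋆ b)))            ≡⟨ cong (lincomb x) (L-⋆ a b) ⟩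
        lincomb x (map (L a) (basis (L b)))      ≡⟨ lincomb-map {f = L a} (L-⊕ a) x (basis (L b)) ⟩
        L a (lincomb x (basis (L b)))            ≡⟨ cong (L a) (linear b x) ⟩
        L a (L b x)                              ∎
    ; ⋆-inv = ⋆-inv
    ; inv-⋆ = inv-⋆
    }
    where
    open ≡-Reasoning
    -- Agreement with a matrix gives additivity while testing only one vector `x` at a time instead
    -- of pairs.
    L-⊕ : ∀ a → Additive (L a)
    L-⊕ a x y = trans (sym (linear a (x ⊕ y))) (trans (lincomb-additive (basis (L a)) x y) (cong₂ _⊕_ (linear a x) (linear a y)))

module _ (G : RegularGroup r) (τ : F r → F r) where
  open RegularGroup G

  IsAutomorphism : Set
  IsAutomorphism = τ 𝟎 ≡ 𝟎 × (∀ a b → τ (a ⋆ b) ≡ τ a ⋆ τ b) × (∀ a → τ (τ a) ≡ a)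

  isAutomorphism? : Dec IsAutomorphism
  isAutomorphism? = (τ 𝟎 ≟ 𝟎) ×-dec ∀? r (λ a → ∀? r λ b → τ (a ⋆ b) ≟ τ a ⋆ τ b) ×-dec ∀? r (λ a → τ (τ a) ≟ a)

  automorphism : IsAutomorphism → Automorphism G
  automorphism (τ-𝟎 , τ-⋆ , τ-involutive) = record { τ = τ ; τ-𝟎 = τ-𝟎 ; τ-⋆ = τ-⋆ ; τ-involutive = τ-involutive }

-- Finite tests for rank and kernel

module _ (τ : F r → F r) where

  Detected : F (r + r) → Set
  Detected u = ∃[ a ] dot u (a ++ τ a) ≡ true

  detected? : Decidable Detected
  detected? u = ∃? r λ a → dot u (a ++ τ a) Bool.≟ true

  Separating : Set
  Separating = ∀ u → u ≡ 𝟎 ⊎ Detected u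

  separating? : Dec Separating
  separating? = ∀? (r + r) λ u → (u ≟ 𝟎) ⊎-dec detected? u

  -- If no nonzero functional annihilates the graph, its span is everything; the test exhibits no
  -- basis.
  fullRank : Separating → RankCertificate τ 0
  fullRank separating = record
    { equations = record { lhs = λ _ _ → [] ; additive = λ _ _ _ _ → refl ; independent = λ { [] → 𝟎 , 𝟎 , refl } }
    ; satisfied = λ _ → refl
    ; complete  = λ x y _ → separating⇒full (span (graph τ)) span-𝟎 span-⊕
        (λ u → Sum.map id (λ (a , eq) → a ++ τ a , ⊆-span (a , refl) , eq) (separating u)) (x ++ y)
    }

  -- The annihilator of the graph consists of 𝟎 and `f`.
  HyperplaneSeparating : F (r + r) → Set
  HyperplaneSeparating f = (∀ a → dot f (a ++ τ a) ≡ false) × (∀ u → u ≡ 𝟎 ⊎ (u ≡ f ⊎ Detected u))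

  hyperplaneSeparating? : Decidable HyperplaneSeparating
  hyperplaneSeparating? f = ∀? r (λ a → dot f (a ++ τ a) Bool.≟ false)
                      ×-dec ∀? (r + r) (λ u → (u ≟ 𝟎) ⊎-dec (u ≟ f) ⊎-dec detected? u)

  -- The span of the graph together with any vector z off the hyperplane is separating, hence
  -- everything; vectors on the hyperplane do not involve z.
  hyperplaneRank : ∀ f z → dot f z ≡ true → HyperplaneSeparating f → RankCertificate τ 1
  hyperplaneRank f z fz (f-graph , separating) = record
    { equations = record
      { lhs         = λ x y → dot f (x ++ y) ∷ []
      ; additive    = λ x x′ y y′ → cong (_∷ []) (trans (cong (dot f) (sym (zipWith-++ _xor_ x y x′ y′))) (dot-⊕ f (x ++ y) (x′ ++ y′)))
      ; independent = λ { (true ∷ []) → take r z , drop r z , cong (_∷ []) (trans (cong (dot f) (take++drop≡id r z)) fz)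
                        ; (false ∷ []) → 𝟎 , 𝟎 , cong (_∷ []) (trans (cong (dot f) (𝟎++𝟎 r)) f𝟎) }
      }
    ; satisfied = λ a → cong (_∷ []) (f-graph a)
    ; complete  = λ x y eq → on-hyperplane (∷-injectiveˡ eq) (separating⇒full V (inj₁ span-𝟎) V-⊕ separating′ (x ++ y))
    }
    where
    f𝟎 : dot f 𝟎 ≡ false
    f𝟎 = functional-𝟎 {f = dot f} (dot-⊕ f)
    V : Code (r + r)
    V x = span (graph τ) x ⊎ span (graph τ) (z ⊕ x)
    V-⊕ : ∀ {x y} → V x → V y → V (x ⊕ y)
    V-⊕ (inj₁ p) (inj₁ q) = inj₁ (span-⊕ p q)
    V-⊕ {x} {y} (inj₁ p) (inj₂ q) = inj₂ (subst (span (graph τ)) (x⊕yz≡y⊕xz x z y) (span-⊕ p q))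
    V-⊕ {x} {y} (inj₂ p) (inj₁ q) = inj₂ (subst (span (graph τ)) (⊕-assoc z x y) (span-⊕ p q))
    V-⊕ {x} {y} (inj₂ p) (inj₂ q) = inj₁ (subst (span (graph τ))
      (trans (⊕-interchange z x z y) (trans (cong (_⊕ (x ⊕ y)) (⊕-self z)) (⊕-identityˡ _))) (span-⊕ p q))
    separating′ : ∀ u → u ≡ 𝟎 ⊎ ∃[ v ] (V v × dot u v ≡ true)
    separating′ u with separating u
    ... | inj₁ u≡𝟎             = inj₁ u≡𝟎
    ... | inj₂ (inj₁ refl)     = inj₂ (z , inj₂ (subst (span (graph τ)) (sym (⊕-self z)) span-𝟎) , fz)
    ... | inj₂ (inj₂ (a , eq)) = inj₂ (a ++ τ a , inj₁ (⊆-span (a , refl)) , eq)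
    f-span : span (graph τ) ⊆ λ x → dot f x ≡ false
    f-span = span-least {V = λ x → dot f x ≡ false} f𝟎
      (λ {x} {y} p q → trans (dot-⊕ f x y) (cong₂ _xor_ p q)) (λ { (a , refl) → f-graph a })
    on-hyperplane : ∀ {x} → dot f x ≡ false → V x → span (graph τ) x
    on-hyperplane fx (inj₁ p) = p
    on-hyperplane {x} fx (inj₂ p) = contradiction
      (trans (sym (cong₂ _xor_ fz fx)) (trans (sym (dot-⊕ f z x)) (f-span p))) λ ()

  -- Evaluating a period at 𝟎 forces its second component to be the image of the first, so periods
  -- are sought over `F r` instead of over pairs.
  Linear : F r → Set
  Linear a = ∀ z → τ (a ⊕ z) ≡ τ a ⊕ τ z

  linear? : Decidable Linear
  linear? a = ∀? r λ z → τ (a ⊕ z) ≟ τ a ⊕ τ z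

  period⇒≡ : τ 𝟎 ≡ 𝟎 → ∀ x y → Period τ x y → τ x ≡ y
  period⇒≡ τ-𝟎 x y p = trans (cong τ (sym (⊕-identityʳ x))) (trans (p 𝟎) (trans (cong (y ⊕_) τ-𝟎) (⊕-identityʳ y)))

  period⇒linear : τ 𝟎 ≡ 𝟎 → ∀ x y → Period τ x y → Linear x
  period⇒linear τ-𝟎 x y p z = trans (p z) (cong (_⊕ τ z) (sym (period⇒≡ τ-𝟎 x y p)))

  period-𝟎 : Period τ 𝟎 𝟎
  period-𝟎 z = trans (cong τ (⊕-identityˡ z)) (sym (⊕-identityˡ (τ z)))

  TrivialKernel : Set
  TrivialKernel = τ 𝟎 ≡ 𝟎 × (∀ a → Linear a → a ≡ 𝟎)

  trivialKernel? : Dec TrivialKernel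
  trivialKernel? = (τ 𝟎 ≟ 𝟎) ×-dec ∀? r (λ a → linear? a →-dec (a ≟ 𝟎))

  trivialKernel : TrivialKernel → KernelCertificate τ (r + r)
  trivialKernel (τ-𝟎 , trivial) = record
    { equations = record
      { lhs         = _++_
      ; additive    = λ x x′ y y′ → sym (zipWith-++ _xor_ x y x′ y′)
      ; independent = λ z → take r z , drop r z , take++drop≡id r z
      }
    ; sound     = λ x y eq → let p , q = ++-injective x 𝟎 (trans eq (sym (𝟎++𝟎 r))) in subst₂ (Period τ) (sym p) (sym q) period-𝟎
    ; complete  = λ x y p → let x≡𝟎 = trivial x (period⇒linear τ-𝟎 x y p) in
        trans (cong₂ _++_ x≡𝟎 (trans (sym (period⇒≡ τ-𝟎 x y p)) (trans (cong τ x≡𝟎) τ-𝟎))) (𝟎++𝟎 r)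
    }

module _ (τ : F (suc r) → F (suc r)) where
  private
    u : F (suc r)
    u = true ∷ 𝟎

  LineKernel : Set
  LineKernel = τ 𝟎 ≡ 𝟎 × Period τ u u × (∀ a → Linear τ a → a ≡ 𝟎 ⊎ a ≡ u)

  lineKernel? : Dec LineKernel
  lineKernel? = (τ 𝟎 ≟ 𝟎) ×-dec ∀? (suc r) (λ z → τ (u ⊕ z) ≟ u ⊕ τ z)
          ×-dec ∀? (suc r) (λ a → linear? τ a →-dec ((a ≟ 𝟎) ⊎-dec (a ≟ u)))

  lineKernel : LineKernel → KernelCertificate τ (r + suc r)
  lineKernel (τ-𝟎 , u-period , line) = record
    { equations = record
      { lhs         = lhs
      ; additive    = λ { (b ∷ x) (c ∷ x′) y y′ → trans
          (cong ((x ⊕ x′) ++_) (trans (cong ((y ⊕ y′) ⊕_) (cong ((b xor c) ∷_) (sym (⊕-self 𝟎)))) (⊕-interchange y y′ (b ∷ 𝟎) (c ∷ 𝟎))))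
          (sym (zipWith-++ _xor_ x (y ⊕ (b ∷ 𝟎)) x′ (y′ ⊕ (c ∷ 𝟎)))) }
      ; independent = λ z → false ∷ take r z , drop r z , trans (cong (take r z ++_) (⊕-identityʳ (drop r z))) (take++drop≡id r z)
      }
    ; sound     = sound
    ; complete  = complete
    }
    where
    -- A pair is reduced by b times (u , u), which clears the first coordinate of its first
    -- component. The remaining r + suc r coordinates vanish exactly on the multiples of (u , u).
    lhs : F (suc r) → F (suc r) → F (r + suc r)
    lhs (b ∷ x) y = x ++ (y ⊕ (b ∷ 𝟎))
    sound : ∀ x y → lhs x y ≡ 𝟎 → Period τ x y
    sound (b ∷ x) y eq with ++-injective x 𝟎 (trans eq (sym (𝟎++𝟎 r)))
    ... | refl , q with ⊕≡𝟎⇒≡ y (b ∷ 𝟎) q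
    sound (false ∷ _) _ eq | refl , q | refl = period-𝟎 τ
    sound (true ∷ _)  _ eq | refl , q | refl = u-period
    complete : ∀ x y → Period τ x y → lhs x y ≡ 𝟎
    complete x y p with line x (period⇒linear τ τ-𝟎 x y p) | period⇒≡ τ τ-𝟎 x y p
    ... | inj₁ refl | refl = trans (cong (𝟎 ++_) (trans (cong (_⊕ 𝟎) τ-𝟎) (⊕-self 𝟎))) (𝟎++𝟎 r)
    ... | inj₂ refl | refl = trans (cong (𝟎 ++_) (trans (cong (_⊕ u) (period⇒≡ τ τ-𝟎 u u u-period)) (⊕-self u))) (𝟎++𝟎 r)

-- s and k are the codimensions in F (r + r) of the span of the graph of τ and of its space of periods.
record Block (r s k : ℕ) : Set where
  constructor block
  field
    {group}      : RegularGroup r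
    automorph    : Automorphism group
    rank         : RankCertificate (Automorphism.τ automorph) s
    kernel       : KernelCertificate (Automorphism.τ automorph) k

-- Examples in dimensions 3, 4 and 5

-- All of them were found by computer search.  The additivity of τ₄ along its first coordinate
-- accounts for the period of block₄, the invariance of a₄ under τ₄′ for the rank of block₄′.

-- In this and the following examples the matrix of `L a` is unipotent, and each entry above its
-- unit diagonal is a sum of coordinates of a and of τ a.
L₃ : F 3 → F 3 → F 3
L₃ (a₁ ∷ a₂ ∷ a₃ ∷ []) (b₁ ∷ b₂ ∷ b₃ ∷ []) =
  (b₁ xor a₃ ∧ b₂ xor (a₁ xor a₂ xor a₁ ∧ a₃) ∧ b₃) ∷
  (b₂ xor (a₁ xor a₂ ∧ a₃) ∧ b₃) ∷
  b₃ ∷ []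

τ₃ : F 3 → F 3
τ₃ (a₁ ∷ a₂ ∷ a₃ ∷ []) =
  (a₁ xor a₁ ∧ a₂ xor a₃) ∷
  (a₁ xor a₂ xor a₃ xor a₁ ∧ a₃) ∷
  (a₁ xor a₂ ∧ a₃) ∷ []

group₃ : RegularGroup 3
group₃ = regularGroup L₃ (from-yes (isRegular? L₃))

block₃ : Block 3 0 6
block₃ = block (automorphism group₃ τ₃ (from-yes (isAutomorphism? group₃ τ₃)))
               (fullRank τ₃ (from-yes (separating? τ₃)))
               (trivialKernel τ₃ (from-yes (trivialKernel? τ₃)))

L₄ : F 4 → F 4 → F 4
L₄ (a₁ ∷ a₂ ∷ a₃ ∷ a₄ ∷ []) (b₁ ∷ b₂ ∷ b₃ ∷ b₄ ∷ []) =
  (b₁ xor (a₂ xor a₄ xor a₃ ∧ a₄) ∧ b₂ xor (a₃ xor a₂ ∧ a₄ xor a₃ ∧ a₄) ∧ b₃ xor a₄ ∧ b₄) ∷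
  (b₂ xor (a₂ ∧ a₃ xor a₄) ∧ b₃ xor a₃ ∧ b₄) ∷
  b₃ ∷
  ((a₂ xor a₄ xor a₃ ∧ a₄) ∧ b₃ xor b₄) ∷ []

τ₄ : F 4 → F 4
τ₄ (a₁ ∷ a₂ ∷ a₃ ∷ a₄ ∷ []) =
  (a₁ xor a₂ ∧ a₄ xor a₂ ∧ a₃ ∧ a₄) ∷
  (a₃ xor a₂ ∧ a₄ xor a₃ ∧ a₄) ∷
  (a₂ xor a₄ xor a₃ ∧ a₄) ∷
  (a₂ ∧ a₃ xor a₄) ∷ []

group₄ : RegularGroup 4
group₄ = regularGroup L₄ (from-yes (isRegular? L₄))

block₄ : Block 4 0 7
block₄ = block (automorphism group₄ τ₄ (from-yes (isAutomorphism? group₄ τ₄)))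
               (fullRank τ₄ (from-yes (separating? τ₄)))
               (lineKernel τ₄ (from-yes (lineKernel? τ₄)))

-- The product of `group₃` with the additive group of one more coordinate. On a₄ = 0 the map `τ₄′`
-- restricts to `τ₃`.
L₄′ : F 4 → F 4 → F 4
L₄′ (a₁ ∷ a₂ ∷ a₃ ∷ a₄ ∷ []) (b₁ ∷ b₂ ∷ b₃ ∷ b₄ ∷ []) =
  (b₁ xor a₃ ∧ b₂ xor (a₁ xor a₂ xor a₁ ∧ a₃) ∧ b₃) ∷
  (b₂ xor (a₁ xor a₂ ∧ a₃) ∧ b₃) ∷
  b₃ ∷
  b₄ ∷ []

τ₄′ : F 4 → F 4
τ₄′ (a₁ ∷ a₂ ∷ a₃ ∷ a₄ ∷ []) =
  (a₁ xor a₁ ∧ a₂ xor a₃ xor a₁ ∧ a₄ xor a₂ ∧ a₃ ∧ a₄) ∷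
  (a₁ xor a₂ xor a₃ xor a₁ ∧ a₃ xor a₄) ∷
  (a₁ xor a₂ ∧ a₃) ∷
  a₄ ∷ []

group₄′ : RegularGroup 4
group₄′ = regularGroup L₄′ (from-yes (isRegular? L₄′))

block₄′ : Block 4 1 8
block₄′ = block (automorphism group₄′ τ₄′ (from-yes (isAutomorphism? group₄′ τ₄′)))
                (hyperplaneRank τ₄′ f z refl (from-yes (hyperplaneSeparating? τ₄′ f)))
                (trivialKernel τ₄′ (from-yes (trivialKernel? τ₄′)))
  where
  u f z : F _
  u = false ∷ false ∷ false ∷ true ∷ []
  -- `f` adds the fourth coordinates of the two halves; `z` has a one in only one of these places.
  f = u ++ u
  z = u ++ 𝟎 {4}

L₅ : F 5 → F 5 → F 5
L₅ (a₁ ∷ a₂ ∷ a₃ ∷ a₄ ∷ a₅ ∷ []) (b₁ ∷ b₂ ∷ b₃ ∷ b₄ ∷ b₅ ∷ []) =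
  (b₁ xor (a₁ ∧ a₃ xor a₄) ∧ b₃ xor a₃ ∧ b₄) ∷
  (b₂ xor a₅ ∧ b₃ xor a₃ ∧ b₅) ∷
  b₃ ∷
  ((a₁ xor a₄ xor a₃ ∧ a₄) ∧ b₃ xor b₄) ∷
  b₅ ∷ []

τ₅ : F 5 → F 5
τ₅ (a₁ ∷ a₂ ∷ a₃ ∷ a₄ ∷ a₅ ∷ []) =
  (a₃ xor a₁ ∧ a₄ xor a₃ ∧ a₄) ∷
  (a₁ ∧ a₂ xor a₂ ∧ a₄ xor a₂ ∧ a₃ ∧ a₄ xor a₅ xor a₁ ∧ a₃ ∧ a₅) ∷
  (a₁ xor a₄ xor a₃ ∧ a₄) ∷
  (a₁ ∧ a₃ xor a₄) ∷
  (a₂ xor a₃ ∧ a₅) ∷ []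

group₅ : RegularGroup 5
group₅ = regularGroup L₅ (from-yes (isRegular? L₅))

block₅ : Block 5 0 10
block₅ = block (automorphism group₅ τ₅ (from-yes (isAutomorphism? group₅ τ₅)))
               (fullRank τ₅ (from-yes (separating? τ₅)))
               (trivialKernel τ₅ (from-yes (trivialKernel? τ₅)))

-- Direct products

infixr 5 _⊠_
_⊠_ : (F m → F k) → (F n → F d) → F (m + n) → F (k + d)
_⊠_ {m} f g x = f (take m x) ++ g (drop m x)

⊠-++ : (f : F m → F k) (g : F n → F d) (x : F m) (y : F n) → (f ⊠ g) (x ++ y) ≡ f x ++ g y
⊠-++ f g x y = cong₂ _++_ (cong f (take-++ x y)) (cong g (drop-++ x y))

⊠-additive : {f : F m → F k} {g : F n → F d} → Additive f → Additive g → Additive (f ⊠ g)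
⊠-additive {m} {f = f} {g} f-⊕ g-⊕ x y = trans
  (cong₂ _++_ (trans (cong f (take-⊕ m x y)) (f-⊕ _ _)) (trans (cong g (drop-⊕ m x y)) (g-⊕ _ _)))
  (sym (zipWith-++ _xor_ (f (take m x)) (g (drop m x)) _ _))

⊕-++ : ∀ m (x : F (m + n)) (y : F m) (z : F n) → x ⊕ (y ++ z) ≡ (take m x ⊕ y) ++ (drop m x ⊕ z)
⊕-++ m x y z = trans (cong (_⊕ (y ++ z)) (sym (take++drop≡id m x))) (zipWith-++ _xor_ (take m x) (drop m x) y z)

take-⊕-++ : ∀ m (x : F (m + n)) (y : F m) (z : F n) → take m (x ⊕ (y ++ z)) ≡ take m x ⊕ y
take-⊕-++ m x y z = trans (cong (take m) (⊕-++ m x y z)) (take-++ _ _)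

drop-⊕-++ : ∀ m (x : F (m + n)) (y : F m) (z : F n) → drop m (x ⊕ (y ++ z)) ≡ drop m x ⊕ z
drop-⊕-++ m x y z = trans (cong (drop m) (⊕-++ m x y z)) (drop-++ (take m x ⊕ y) _)

take-𝟎 : ∀ m → take m (𝟎 {m + n}) ≡ 𝟎
take-𝟎 m = additive-𝟎 (take-⊕ m)

drop-𝟎 : ∀ m → drop m (𝟎 {m + n}) ≡ 𝟎
drop-𝟎 m = additive-𝟎 (drop-⊕ m)

_×ᴳ_ : RegularGroup m → RegularGroup n → RegularGroup (m + n)
_×ᴳ_ {m} {n} G H = record
  { L     = L
  ; inv   = inv
  ; L-⊕   = λ a → ⊠-additive {f = G.L (take m a)} {H.L (drop m a)} (G.L-⊕ (take m a)) (H.L-⊕ (drop m a))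
  ; L-𝟎   = λ x → trans (cong₂ _++_
      (trans (cong (λ a → G.L a (take m x)) (take-𝟎 m)) (G.L-𝟎 (take m x)))
      (trans (cong (λ a → H.L a (drop m x)) (drop-𝟎 m)) (H.L-𝟎 (drop m x))))
      (take++drop≡id m x)
  ; L-⋆   = λ a b x → trans (cong₂ _++_
      (trans (cong (λ c → G.L c (take m x)) (take-⊕-++ m a _ _)) (G.L-⋆ (take m a) (take m b) (take m x)))
      (trans (cong (λ c → H.L c (drop m x)) (drop-⊕-++ m a _ _)) (H.L-⋆ (drop m a) (drop m b) (drop m x))))
      (sym (⊠-++ (G.L (take m a)) (H.L (drop m a)) (G.L (take m b) (take m x)) (H.L (drop m b) (drop m x))))
  ; ⋆-inv = λ a → begin
      a ⊕ L a (inv a)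
        ≡⟨ cong (a ⊕_) (⊠-++ (G.L (take m a)) (H.L (drop m a)) (G.inv (take m a)) (H.inv (drop m a))) ⟩
      a ⊕ (G.L (take m a) (G.inv (take m a)) ++ H.L (drop m a) (H.inv (drop m a)))
        ≡⟨ ⊕-++ m a _ _ ⟩
      (take m a G.⋆ G.inv (take m a)) ++ (drop m a H.⋆ H.inv (drop m a))
        ≡⟨ trans (cong₂ _++_ (G.⋆-inv (take m a)) (H.⋆-inv (drop m a))) (𝟎++𝟎 m) ⟩
      𝟎 ∎
  ; inv-⋆ = λ a → begin
      inv a ⊕ L (inv a) a
        ≡⟨ ⊕-++ m (inv a) _ _ ⟩
      (take m (inv a) G.⋆ take m a) ++ (drop m (inv a) H.⋆ drop m a)
        ≡⟨ cong₂ _++_ (cong (G._⋆ take m a) (take-++ (G.inv (take m a)) (H.inv (drop m a))))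
                      (cong (H._⋆ drop m a) (drop-++ (G.inv (take m a)) (H.inv (drop m a)))) ⟩
      (G.inv (take m a) G.⋆ take m a) ++ (H.inv (drop m a) H.⋆ drop m a)
        ≡⟨ trans (cong₂ _++_ (G.inv-⋆ (take m a)) (H.inv-⋆ (drop m a))) (𝟎++𝟎 m) ⟩
      𝟎 ∎
  }
  where
  open ≡-Reasoning
  module G = RegularGroup G
  module H = RegularGroup H
  L : F (m + n) → F (m + n) → F (m + n)
  L a = G.L (take m a) ⊠ H.L (drop m a)
  inv : F (m + n) → F (m + n)
  inv = G.inv ⊠ H.inv

_×ᴬ_ : {G : RegularGroup m} {H : RegularGroup n} → Automorphism G → Automorphism H → Automorphism (G ×ᴳ H)
_×ᴬ_ {m} {n} {G} {H} α β = record
  { τ            = α.τ ⊠ β.τ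
  ; τ-𝟎          = trans (cong₂ _++_ (trans (cong α.τ (take-𝟎 m)) α.τ-𝟎) (trans (cong β.τ (drop-𝟎 m)) β.τ-𝟎)) (𝟎++𝟎 m)
  ; τ-⋆          = λ a b → begin
      (α.τ ⊠ β.τ) (a ⊕ (G.L (take m a) ⊠ H.L (drop m a)) b)
        ≡⟨ trans (cong (α.τ ⊠ β.τ) (⊕-++ m a _ _)) (⊠-++ α.τ β.τ _ _) ⟩
      α.τ (take m a G.⋆ take m b) ++ β.τ (drop m a H.⋆ drop m b)
        ≡⟨ cong₂ _++_ (α.τ-⋆ (take m a) (take m b)) (β.τ-⋆ (drop m a) (drop m b)) ⟩
      (α.τ (take m a) G.⋆ α.τ (take m b)) ++ (β.τ (drop m a) H.⋆ β.τ (drop m b))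
        ≡⟨ zipWith-++ _xor_ (α.τ (take m a)) (β.τ (drop m a)) _ _ ⟨
      (α.τ ⊠ β.τ) a ⊕ (G.L (α.τ (take m a)) (α.τ (take m b)) ++ H.L (β.τ (drop m a)) (β.τ (drop m b)))
        ≡⟨ cong ((α.τ ⊠ β.τ) a ⊕_) (⊠-++ (G.L (α.τ (take m a))) (H.L (β.τ (drop m a))) (α.τ (take m b)) (β.τ (drop m b))) ⟨
      (α.τ ⊠ β.τ) a ⊕ (G.L (α.τ (take m a)) ⊠ H.L (β.τ (drop m a))) ((α.τ ⊠ β.τ) b)
        ≡⟨ cong₂ (λ c d → (α.τ ⊠ β.τ) a ⊕ (G.L c ⊠ H.L d) ((α.τ ⊠ β.τ) b))
             (take-++ (α.τ (take m a)) (β.τ (drop m a))) (drop-++ (α.τ (take m a)) (β.τ (drop m a))) ⟨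
      (α.τ ⊠ β.τ) a ⊕ (G.L (take m ((α.τ ⊠ β.τ) a)) ⊠ H.L (drop m ((α.τ ⊠ β.τ) a))) ((α.τ ⊠ β.τ) b) ∎
  ; τ-involutive = λ a → trans (⊠-++ α.τ β.τ (α.τ (take m a)) (β.τ (drop m a)))
      (trans (cong₂ _++_ (α.τ-involutive (take m a)) (β.τ-involutive (drop m a))) (take++drop≡id m a))
  }
  where
  open ≡-Reasoning
  module G = RegularGroup G
  module H = RegularGroup H
  module α = Automorphism α
  module β = Automorphism β

_×ᴱ_ : Equations m k → Equations n d → Equations (m + n) (k + d)
_×ᴱ_ {m} {k} {n} {d} E E′ = record
  { lhs         = λ x y → E.lhs (take m x) (take m y) ++ E′.lhs (drop m x) (drop m y)
  ; additive    = λ x x′ y y′ → trans (cong₂ _++_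
      (trans (cong₂ E.lhs (take-⊕ m x x′) (take-⊕ m y y′)) (E.additive _ _ _ _))
      (trans (cong₂ E′.lhs (drop-⊕ m x x′) (drop-⊕ m y y′)) (E′.additive _ _ _ _)))
      (sym (zipWith-++ _xor_ (E.lhs (take m x) (take m y)) _ _ _))
  ; independent = independent
  }
  where
  module E = Equations E
  module E′ = Equations E′
  independent : ∀ z → ∃₂ λ x y → E.lhs (take m x) (take m y) ++ E′.lhs (drop m x) (drop m y) ≡ z
  independent z with E.independent (take k z) | E′.independent (drop k z)
  ... | x , y , p | x′ , y′ , q = x ++ x′ , y ++ y′ , trans (cong₂ _++_
    (trans (cong₂ E.lhs (take-++ x x′) (take-++ y y′)) p)
    (trans (cong₂ E′.lhs (drop-++ x x′) (drop-++ y y′)) q)) (take++drop≡id k z)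

module _ {E : Equations m k} {E′ : Equations n d} where
  private
    module E = Equations E
    module E′ = Equations E′

  solution-×⁻ : ∀ x y → Equations.Solution (E ×ᴱ E′) x y →
                E.Solution (take m x) (take m y) × E′.Solution (drop m x) (drop m y)
  solution-×⁻ x y eq = ++-injective (E.lhs (take m x) (take m y)) 𝟎 (trans eq (sym (𝟎++𝟎 k)))

  solution-×⁺ : ∀ x y → E.Solution (take m x) (take m y) → E′.Solution (drop m x) (drop m y) →
                Equations.Solution (E ×ᴱ E′) x y
  solution-×⁺ x y p q = trans (cong₂ _++_ p q) (𝟎++𝟎 k)

span-map : {C : Code m} {D : Code n} {f : F m → F n} → Additive f → (∀ {x} → C x → D (f x)) → ∀ {x} → span C x → span D (f x)
span-map {D = D} {f} f-⊕ C→D = span-least {V = span D ∘ f}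
  (subst (span D) (sym (additive-𝟎 f-⊕)) span-𝟎)
  (λ {x} {y} p q → subst (span D) (sym (f-⊕ x y)) (span-⊕ p q))
  (⊆-span ∘ C→D)

-- When `f` intertwines the two maps, `f ⊠ f` carries one graph into the other; the inclusions of
-- the factors of a product are of this kind.
span-graph-map : {σ : F m → F m} {τ : F n → F n} {f : F m → F n} → Additive f → (∀ a → τ (f a) ≡ f (σ a)) →
                 ∀ x y → span (graph σ) (x ++ y) → span (graph τ) (f x ++ f y)
span-graph-map {σ = σ} {τ} {f} f-⊕ τ∘f x y p = subst (span (graph τ)) (⊠-++ f f x y)
  (span-map {f = f ⊠ f} (⊠-additive {f = f} {f} f-⊕ f-⊕)
    (λ { (a , refl) → f a , trans (cong (f a ++_) (τ∘f a)) (sym (⊠-++ f f a (σ a))) }) p)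

++𝟎-additive : Additive {m} {m + n} (_++ 𝟎)
++𝟎-additive x y = trans (cong ((x ⊕ y) ++_) (sym (⊕-self 𝟎))) (sym (zipWith-++ _xor_ x 𝟎 y 𝟎))

𝟎++-additive : Additive {n} {m + n} (𝟎 ++_)
𝟎++-additive x y = trans (cong (_++ (x ⊕ y)) (sym (⊕-self 𝟎))) (sym (zipWith-++ _xor_ 𝟎 x 𝟎 y))

module _ {σ : F m → F m} {τ : F n → F n} (σ-𝟎 : σ 𝟎 ≡ 𝟎) (τ-𝟎 : τ 𝟎 ≡ 𝟎) where

  -- Since both maps fix 𝟎, the graph of the product contains a copy of each factor graph, and the
  -- two spans add up.
  rank-× : RankCertificate σ k → RankCertificate τ d → RankCertificate (σ ⊠ τ) (k + d)
  rank-× R R′ = record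
    { equations = R.equations ×ᴱ R′.equations
    ; satisfied = λ a → solution-×⁺ {E = R.equations} {R′.equations} a ((σ ⊠ τ) a)
        (trans (cong (Equations.lhs R.equations (take m a)) (take-++ (σ (take m a)) (τ (drop m a)))) (R.satisfied (take m a)))
        (trans (cong (Equations.lhs R′.equations (drop m a)) (drop-++ (σ (take m a)) (τ (drop m a)))) (R′.satisfied (drop m a)))
    ; complete  = λ x y s → let p , q = solution-×⁻ {E = R.equations} {R′.equations} x y s in
        subst (span (graph (σ ⊠ τ)))
          (trans (zipWith-++ _xor_ (take m x ++ 𝟎) (take m y ++ 𝟎) (𝟎 ++ drop m x) (𝟎 ++ drop m y)) (cong₂ _++_ (join-halves x) (join-halves y)))
          (span-⊕
            (span-graph-map {σ = σ} {f = _++ 𝟎} ++𝟎-additive (λ a → trans (⊠-++ σ τ a 𝟎) (cong (σ a ++_) τ-𝟎))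
              (take m x) (take m y) (R.complete _ _ p))
            (span-graph-map {σ = τ} {f = 𝟎 ++_} 𝟎++-additive (λ a → trans (⊠-++ σ τ 𝟎 a) (cong (_++ τ a) σ-𝟎))
              (drop m x) (drop m y) (R′.complete _ _ q)))
    }
    where
    module R = RankCertificate R
    module R′ = RankCertificate R′
    join-halves : (x : F (m + n)) → (take m x ++ 𝟎) ⊕ (𝟎 ++ drop m x) ≡ x
    join-halves x = trans (zipWith-++ _xor_ (take m x) 𝟎 𝟎 (drop m x))
      (trans (cong₂ _++_ (⊕-identityʳ (take m x)) (⊕-identityˡ (drop m x))) (take++drop≡id m x))

  -- A period of the product gives one of each factor when the argument in the other half is held at
  -- 𝟎.
  kernel-× : KernelCertificate σ k → KernelCertificate τ d → KernelCertificate (σ ⊠ τ) (k + d)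
  kernel-× K K′ = record
    { equations = K.equations ×ᴱ K′.equations
    ; sound     = λ x y s z → let p , q = solution-×⁻ {E = K.equations} {K′.equations} x y s in begin
        (σ ⊠ τ) (x ⊕ z)
          ≡⟨ cong₂ _++_ (trans (cong σ (take-⊕ m x z)) (K.sound _ _ p (take m z))) (trans (cong τ (drop-⊕ m x z)) (K′.sound _ _ q (drop m z))) ⟩
        (take m y ⊕ σ (take m z)) ++ (drop m y ⊕ τ (drop m z))
          ≡⟨ ⊕-++ m y _ _ ⟨
        y ⊕ (σ ⊠ τ) z ∎
    ; complete  = λ x y p → solution-×⁺ {E = K.equations} {K′.equations} x y
        (K.complete _ _ λ z → proj₁ (halves x y p z 𝟎))
        (K′.complete _ _ λ z → proj₂ (halves x y p 𝟎 z))
    }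
    where
    open ≡-Reasoning
    module K = KernelCertificate K
    module K′ = KernelCertificate K′
    halves : ∀ x y → Period (σ ⊠ τ) x y → ∀ z z′ → σ (take m x ⊕ z) ≡ take m y ⊕ σ z × τ (drop m x ⊕ z′) ≡ drop m y ⊕ τ z′
    halves x y p z z′ = ++-injective (σ (take m x ⊕ z)) (take m y ⊕ σ z) (begin
      σ (take m x ⊕ z) ++ τ (drop m x ⊕ z′)               ≡⟨ ⊠-++ σ τ (take m x ⊕ z) (drop m x ⊕ z′) ⟨
      (σ ⊠ τ) ((take m x ⊕ z) ++ (drop m x ⊕ z′))         ≡⟨ cong (σ ⊠ τ) (⊕-++ m x z z′) ⟨
      (σ ⊠ τ) (x ⊕ (z ++ z′))                             ≡⟨ p (z ++ z′) ⟩
      y ⊕ (σ ⊠ τ) (z ++ z′)                               ≡⟨ cong (y ⊕_) (⊠-++ σ τ z z′) ⟩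
      y ⊕ (σ z ++ τ z′)                                   ≡⟨ ⊕-++ m y (σ z) (τ z′) ⟩
      (take m y ⊕ σ z) ++ (drop m y ⊕ τ z′)               ∎)

_×ᴮ_ : ∀ {s s′} → Block m s k → Block n s′ d → Block (m + n) (s + s′) (k + d)
A ×ᴮ B = block (A.automorph ×ᴬ B.automorph)
  (rank-× (Automorphism.τ-𝟎 A.automorph) (Automorphism.τ-𝟎 B.automorph) A.rank B.rank)
  (kernel-× (Automorphism.τ-𝟎 A.automorph) (Automorphism.τ-𝟎 B.automorph) A.kernel B.kernel)
  where
  module A = Block A
  module B = Block B

-- Assembly over the residues of r modulo 3

tower : ∀ j → Block r s k → Block (j * 3 + r) s (j * 6 + k)
tower zero    B = B
-- With `block₃` on the left the three indices agree by computation.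
tower (suc j) B = block₃ ×ᴮ tower j B

Conclusion : ℕ → ℕ → ℕ → Set₁
Conclusion r c d = Σ[ τ ∈ F r ⤖ F r ]
  ( IsPropelinear (S τ)
  × IsExtendedPerfect (S τ)
  × codeLength (S τ) ≡ 2 ^ (r + 1)
  × HasRank (S τ) (2 ^ (r + 1) ∸ c)
  × HasDimension (Ker (S τ)) (2 ^ (r + 1) ∸ 2 * r ∸ d))

length-S : ∀ r → 2 ^ r + 2 ^ r ≡ 2 ^ (r + 1)
length-S r = trans (cong (2 ^ r +_) (sym (ℕ.+-identityʳ (2 ^ r)))) (cong (2 ^_) (ℕ.+-comm 1 r))

block⇒conclusion : Block r s k → 2 + k ≡ 2 * r + d → Conclusion r (2 + s) d
block⇒conclusion {r} {s} {d = d} B eq =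
    bijection
  , propelinear
  , S-extendedPerfect bijection
  , length-S r
  , subst (λ N → HasRank (S bijection) (N ∸ (2 + s))) (length-S r) (rank-S bijection τ-𝟎 rank)
  , subst (HasDimension (Ker (S bijection)))
      (trans (cong₂ _∸_ (length-S r) eq) (sym (ℕ.∸-+-assoc (2 ^ (r + 1)) (2 * r) d)))
      (kernel-S bijection τ-𝟎 kernel)
  where
  open Block B
  open Automorphism automorph

-- The starting block has dimension 3 + r % 3, so one copy fewer than r / 3 is added; 3 ≤ r excludes
-- quotient zero.
r≡3j+3+r%3 : ∀ r → 3 ≤ r → ∃[ j ] r ≡ j * 3 + (3 + r % 3)
r≡3j+3+r%3 r 3≤r with r / 3 | m≡m%n+[m/n]*n r 3
... | suc j | eq = j , trans eq (rearrange (r % 3) j)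
  where
  rearrange : ∀ a j → a + suc j * 3 ≡ j * 3 + (3 + a)
  rearrange = solve-∀
... | zero | eq = contradiction (ℕ.≤-trans 3≤r (ℕ.≤-reflexive (trans eq (ℕ.+-identityʳ (r % 3))))) (ℕ.<⇒≱ (m%n<n r 3))

tower⇒conclusion : ∀ {a} → Block (3 + a) s k → 2 + k ≡ 2 * (3 + a) + d →
                   3 ≤ r → r % 3 ≡ a → Conclusion r (2 + s) d
tower⇒conclusion {s} {k} {d} {r} {a} B eq 3≤r r%3≡a with r≡3j+3+r%3 r 3≤r
... | j , r≡ = subst (λ r → Conclusion r (2 + s) d) (sym (trans r≡ (cong (λ a → j * 3 + (3 + a)) r%3≡a)))
  (block⇒conclusion (tower j B) (begin
    2 + (j * 6 + k)                 ≡⟨ shift j k ⟩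
    j * 6 + (2 + k)                 ≡⟨ cong (j * 6 +_) eq ⟩
    j * 6 + (2 * (3 + a) + d)       ≡⟨ collect j a d ⟩
    2 * (j * 3 + (3 + a)) + d       ∎))
  where
  open ≡-Reasoning
  shift : ∀ j k → 2 + (j * 6 + k) ≡ j * 6 + (2 + k)
  shift = solve-∀
  collect : ∀ j a d → j * 6 + (2 * (3 + a) + d) ≡ 2 * (j * 3 + (3 + a)) + d
  collect = solve-∀

corollary2 : ∀ (r : ℕ) → 3 ≤ r →
    ((r % 3 ≡ 0 ⊎ r % 3 ≡ 2) →
    Σ[ τ ∈ F r ⤖ F r ]
    ( IsPropelinear (S τ)
    × IsExtendedPerfect (S τ)
    × codeLength (S τ) ≡ 2 ^ (r + 1)
    × HasRank (S τ) (2 ^ (r + 1) ∸ 2)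
    × HasDimension (Ker (S τ)) (2 ^ (r + 1) ∸ 2 * r ∸ 2)))
    ×
    (r % 3 ≡ 1 →
    (Σ[ τ ∈ F r ⤖ F r ]
    ( IsPropelinear (S τ)
    × IsExtendedPerfect (S τ)
    × codeLength (S τ) ≡ 2 ^ (r + 1)
    × HasRank (S τ) (2 ^ (r + 1) ∸ 2)
    × HasDimension (Ker (S τ)) (2 ^ (r + 1) ∸ 2 * r ∸ 1)))
    ×
    (Σ[ τ ∈ F r ⤖ F r ]
    ( IsPropelinear (S τ)
    × IsExtendedPerfect (S τ)
    × codeLength (S τ) ≡ 2 ^ (r + 1)
    × HasRank (S τ) (2 ^ (r + 1) ∸ 3)
    × HasDimension (Ker (S τ)) (2 ^ (r + 1) ∸ 2 * r ∸ 2))))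
corollary2 r 3≤r =
    -- The dimension counts verified by `refl` are 8 = 6 + 2 and 12 = 10 + 2.
    [ tower⇒conclusion block₃ refl 3≤r , tower⇒conclusion block₅ refl 3≤r ]′
  -- Here they are 9 = 8 + 1, with one line of periods, and 10 = 8 + 2, with the defect in the rank.
  , λ r%3≡1 → tower⇒conclusion block₄ refl 3≤r r%3≡1 , tower⇒conclusion block₄′ refl 3≤r r%3≡1
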